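{- Let $P(X) \in \mathbb{R}[X]$ be a polynomial of degree $k \geq 2$ with positive leading coefficient. Then there is a polynomial $f(X) \in \mathbb{R}[X]$ of degree $k-1$, depending on $P$, with the following property: for every $i_0 \in \mathbb{R}$ such that $P(x) > 0$ for all real $x > i_0$, there is an integer $N_0$ (depending on $f$ and $i_0$) such that, with $x_i = \frac{1}{P(i+i_0)}$ for integers $i \geq 1$, \[ f(n+i_0) < \frac{1}{\sum_{i=n+1}^{\infty} x_i} < f(n+i_0)+1 \] holds for all integers $n \geq N_0$ with $n \geq 0$. Moreover, $f$ is unique up to the constant term: any two real polynomials of degree $k-1$ having this property differ by a constant. -}

module Defs where

open import Data.Nat as ℕ using (ℕ; zero; suc)
import Data.Nat.Properties as ℕ
open import Data.Integer as ℤ using (+_)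
open import Data.Rational as ℚ using (ℚ; 0ℚ; 1ℚ; ½)
import Data.Rational.Properties as ℚ
open import Data.Rational.Solver using (module +-*-Solver)
open import Data.List using (List; []; _∷_; map)
open import Data.Product using (Σ-syntax; ∃-syntax; _×_; _,_)
open import Data.Sum using (_⊎_; inj₁; inj₂)
open import Relation.Nullary using (yes; no; contradiction)
open import Relation.Binary.PropositionalEquality
  using (_≡_; _≢_; refl; sym; trans; cong; cong₂; subst; subst₂)

------------------------------------------------------------------------
-- The real numbers, as Cauchy sequences of rationals.  Each sequence
-- carries a modulus, because ∃ is the constructive one.  Equality of
-- reals is the setoid relation _≈_, not _≡_.

IsCauchy : (ℕ → ℚ) → Set
IsCauchy s = ∀ ε → 0ℚ ℚ.< ε →
  ∃[ N ] ∀ m n → N ℕ.≤ m → N ℕ.≤ n → ℚ.∣ s m ℚ.- s n ∣ ℚ.< ε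

record ℝ : Set where
  constructor mkℝ
  field
    seq    : ℕ → ℚ
    cauchy : IsCauchy seq

open ℝ public

infix 4 _≈_ _<_ _#_

record _≈_ (x y : ℝ) : Set where
  constructor mk≈
  field
    close : ∀ ε → 0ℚ ℚ.< ε →
      ∃[ N ] ∀ n → N ℕ.≤ n → ℚ.∣ seq x n ℚ.- seq y n ∣ ℚ.< ε

record _<_ (x y : ℝ) : Set where
  constructor mk<
  field
    gap   : ℚ
    0<gap : 0ℚ ℚ.< gap
    from  : ℕ
    below : ∀ n → from ℕ.≤ n → seq x n ℚ.+ gap ℚ.≤ seq y n

-- Apartness, the constructive form of x ≠ y.
_#_ : ℝ → ℝ → Set
x # y = x < y ⊎ y < x

------------------------------------------------------------------------
-- Closure of Cauchy sequences under the field operations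

-- Multiplicative inverse, with the junk value 0 at 0.
inv : ℚ → ℚ
inv q with q ℚ.≟ 0ℚ
... | yes _   = 0ℚ
... | no q≢0 = ℚ.1/_ q {{ℚ.≢-nonZero q≢0}}

inv-inverse : ∀ q → q ≢ 0ℚ → inv q ℚ.* q ≡ 1ℚ
inv-inverse q q≢0 with q ℚ.≟ 0ℚ
... | yes q≡0 = contradiction q≡0 q≢0
... | no q≢0′ = ℚ.*-inverseˡ q {{ℚ.≢-nonZero q≢0′}}

private
  0<½ : 0ℚ ℚ.< ½
  0<½ = ℚ.positive⁻¹ ½

  0<1 : 0ℚ ℚ.< 1ℚ
  0<1 = ℚ.positive⁻¹ 1ℚ

  *-pos : ∀ {p q} → 0ℚ ℚ.< p → 0ℚ ℚ.< q → 0ℚ ℚ.< p ℚ.* q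
  *-pos {p} {q} 0<p 0<q =
    ℚ.positive⁻¹ (p ℚ.* q) {{ℚ.pos*pos⇒pos p {{ℚ.positive 0<p}} q {{ℚ.positive 0<q}}}}

  half : ∀ ε → ½ ℚ.* ε ℚ.+ ½ ℚ.* ε ≡ ε
  half ε = trans (sym (ℚ.*-distribʳ-+ ε ½ ½)) (ℚ.*-identityˡ ε)

  -- For B > 0, the quotient ε / B.
  quotient : ∀ B ε → 0ℚ ℚ.< B → 0ℚ ℚ.< ε → ∃[ η ] (0ℚ ℚ.< η × B ℚ.* η ≡ ε)
  quotient B ε 0<B 0<ε = ℚ.1/ B ℚ.* ε , *-pos 0<1/B 0<ε ,
    trans (sym (ℚ.*-assoc B (ℚ.1/ B) ε))
          (trans (cong (ℚ._* ε) (ℚ.*-inverseʳ B)) (ℚ.*-identityˡ ε))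
    where
    instance
      B-pos : ℚ.Positive B
      B-pos = ℚ.positive 0<B
      B-nonZero : ℚ.NonZero B
      B-nonZero = ℚ.pos⇒nonZero B
    0<1/B : 0ℚ ℚ.< ℚ.1/ B
    0<1/B = ℚ.positive⁻¹ (ℚ.1/ B) {{ℚ.1/pos⇒pos B}}

  *-mono-abs : ∀ a b B η → 0ℚ ℚ.< B → ℚ.∣ a ∣ ℚ.≤ B → ℚ.∣ b ∣ ℚ.< η →
    ℚ.∣ a ℚ.* b ∣ ℚ.< B ℚ.* η
  *-mono-abs a b B η 0<B a≤B b<η = subst (ℚ._< B ℚ.* η) (sym (ℚ.∣p*q∣≡∣p∣*∣q∣ a b))
    (ℚ.≤-<-trans (ℚ.*-monoʳ-≤-nonNeg ℚ.∣ b ∣ {{ℚ.nonNegative (ℚ.0≤∣p∣ b)}} a≤B)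
                 (ℚ.*-monoʳ-<-pos B {{ℚ.positive 0<B}} b<η))

  +-swap : ∀ a b c d → (a ℚ.+ b) ℚ.- (c ℚ.+ d) ≡ (a ℚ.- c) ℚ.+ (b ℚ.- d)
  +-swap = solve 4 (λ a b c d → (a :+ b) :- (c :+ d) := (a :- c) :+ (b :- d)) refl
    where open +-*-Solver

  cancel : ∀ a b → a ≡ (a ℚ.- b) ℚ.+ b
  cancel = solve 2 (λ a b → a := (a :- b) :+ b) refl
    where open +-*-Solver

  neg-swap : ∀ a b → ℚ.- (a ℚ.- b) ≡ ℚ.- a ℚ.- ℚ.- b
  neg-swap = solve 2 (λ a b → :- (a :- b) := (:- a) :- (:- b)) refl
    where open +-*-Solver

  *-diff : ∀ a b c d → a ℚ.* b ℚ.- c ℚ.* d ≡ a ℚ.* (b ℚ.- d) ℚ.+ d ℚ.* (a ℚ.- c)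
  *-diff = solve 4 (λ a b c d → a :* b :- c :* d := a :* (b :- d) :+ d :* (a :- c)) refl
    where open +-*-Solver

  cross : ∀ u v a b → u ℚ.* (v ℚ.* b) ℚ.- v ℚ.* (u ℚ.* a) ≡ u ℚ.* (v ℚ.* (b ℚ.- a))
  cross = solve 4 (λ u v a b → u :* (v :* b) :- v :* (u :* a) := u :* (v :* (b :- a))) refl
    where open +-*-Solver

  regroup : ∀ a b c → a ℚ.* (a ℚ.* (b ℚ.* (b ℚ.* c))) ≡ (b ℚ.* a) ℚ.* ((b ℚ.* a) ℚ.* c)
  regroup = solve 3 (λ a b c → a :* (a :* (b :* (b :* c))) := (b :* a) :* ((b :* a) :* c)) refl
    where open +-*-Solver

  cancelˡ : ∀ a d → d ≡ ℚ.- a ℚ.+ (a ℚ.+ d)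
  cancelˡ = solve 2 (λ a d → d := (:- a) :+ (a :+ d)) refl
    where open +-*-Solver

  p≤∣p∣ : ∀ p → p ℚ.≤ ℚ.∣ p ∣
  p≤∣p∣ p with ℚ.≤-total 0ℚ p
  ... | inj₁ 0≤p = ℚ.≤-reflexive (sym (ℚ.0≤p⇒∣p∣≡p 0≤p))
  ... | inj₂ p≤0 = ℚ.≤-trans p≤0 (ℚ.0≤∣p∣ p)

  eventually-bounded : ∀ s → IsCauchy s →
    ∃[ B ] (0ℚ ℚ.< B × ∃[ N ] ∀ n → N ℕ.≤ n → ℚ.∣ s n ∣ ℚ.≤ B)
  eventually-bounded s c with c 1ℚ 0<1
  ... | N , close = B , 0<B , N , bound
    where
    B = 1ℚ ℚ.+ ℚ.∣ s N ∣
    0<B : 0ℚ ℚ.< B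
    0<B = ℚ.+-mono-<-≤ {0ℚ} {1ℚ} {0ℚ} 0<1 (ℚ.0≤∣p∣ (s N))
    bound : ∀ n → N ℕ.≤ n → ℚ.∣ s n ∣ ℚ.≤ B
    bound n N≤n = begin
      ℚ.∣ s n ∣                               ≡⟨ cong ℚ.∣_∣ (cancel (s n) (s N)) ⟩
      ℚ.∣ (s n ℚ.- s N) ℚ.+ s N ∣             ≤⟨ ℚ.∣p+q∣≤∣p∣+∣q∣ (s n ℚ.- s N) (s N) ⟩
      ℚ.∣ s n ℚ.- s N ∣ ℚ.+ ℚ.∣ s N ∣         ≤⟨ ℚ.+-monoˡ-≤ ℚ.∣ s N ∣ (ℚ.<⇒≤ (close n N N≤n ℕ.≤-refl)) ⟩
      B                                       ∎
      where open ℚ.≤-Reasoning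

const-cauchy : ∀ q → IsCauchy (λ _ → q)
const-cauchy q ε 0<ε = 0 , λ _ _ _ _ →
  subst (ℚ._< ε) (sym (cong ℚ.∣_∣ (ℚ.+-inverseʳ q))) 0<ε

+-cauchy : ∀ s t → IsCauchy s → IsCauchy t → IsCauchy (λ n → s n ℚ.+ t n)
+-cauchy s t cs ct ε 0<ε
  with cs (½ ℚ.* ε) (*-pos 0<½ 0<ε) | ct (½ ℚ.* ε) (*-pos 0<½ 0<ε)
... | N , s-close | M , t-close = N ℕ.⊔ M , λ m n m≥ n≥ → begin-strict
    ℚ.∣ (s m ℚ.+ t m) ℚ.- (s n ℚ.+ t n) ∣
      ≡⟨ cong ℚ.∣_∣ (+-swap (s m) (t m) (s n) (t n)) ⟩
    ℚ.∣ (s m ℚ.- s n) ℚ.+ (t m ℚ.- t n) ∣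
      ≤⟨ ℚ.∣p+q∣≤∣p∣+∣q∣ (s m ℚ.- s n) (t m ℚ.- t n) ⟩
    ℚ.∣ s m ℚ.- s n ∣ ℚ.+ ℚ.∣ t m ℚ.- t n ∣
      <⟨ ℚ.+-mono-< (s-close m n (ℕ.m⊔n≤o⇒m≤o N M m≥) (ℕ.m⊔n≤o⇒m≤o N M n≥))
                    (t-close m n (ℕ.m⊔n≤o⇒n≤o N M m≥) (ℕ.m⊔n≤o⇒n≤o N M n≥)) ⟩
    ½ ℚ.* ε ℚ.+ ½ ℚ.* ε
      ≡⟨ half ε ⟩
    ε ∎
  where
  open ℚ.≤-Reasoning

neg-cauchy : ∀ s → IsCauchy s → IsCauchy (λ n → ℚ.- s n)
neg-cauchy s cs ε 0<ε with cs ε 0<ε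
... | N , close = N , λ m n m≥ n≥ → subst (ℚ._< ε)
  (trans (sym (ℚ.∣-p∣≡∣p∣ (s m ℚ.- s n)))
         (cong ℚ.∣_∣ (neg-swap (s m) (s n))))
  (close m n m≥ n≥)

private
  *-close : ∀ a b c d B C η θ → 0ℚ ℚ.< B → 0ℚ ℚ.< C →
    ℚ.∣ a ∣ ℚ.≤ B → ℚ.∣ d ∣ ℚ.≤ C → ℚ.∣ b ℚ.- d ∣ ℚ.< η → ℚ.∣ a ℚ.- c ∣ ℚ.< θ →
    ℚ.∣ a ℚ.* b ℚ.- c ℚ.* d ∣ ℚ.< B ℚ.* η ℚ.+ C ℚ.* θ
  *-close a b c d B C η θ 0<B 0<C a≤B d≤C b-d<η a-c<θ =
    subst (λ x → ℚ.∣ x ∣ ℚ.< B ℚ.* η ℚ.+ C ℚ.* θ) (sym (*-diff a b c d))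
      (ℚ.≤-<-trans (ℚ.∣p+q∣≤∣p∣+∣q∣ (a ℚ.* (b ℚ.- d)) (d ℚ.* (a ℚ.- c)))
        (ℚ.+-mono-< {ℚ.∣ a ℚ.* (b ℚ.- d) ∣} {B ℚ.* η} {ℚ.∣ d ℚ.* (a ℚ.- c) ∣} {C ℚ.* θ}
          (*-mono-abs a (b ℚ.- d) B η 0<B a≤B b-d<η)
          (*-mono-abs d (a ℚ.- c) C θ 0<C d≤C a-c<θ)))

*-cauchy : ∀ s t → IsCauchy s → IsCauchy t → IsCauchy (λ n → s n ℚ.* t n)
*-cauchy s t cs ct ε 0<ε =
  let ½ε = ½ ℚ.* ε
      0<½ε = *-pos 0<½ 0<ε
      B , 0<B , N₁ , s≤B = eventually-bounded s cs
      C , 0<C , N₂ , t≤C = eventually-bounded t ct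
      η , 0<η , Bη≡½ε = quotient B ½ε 0<B 0<½ε
      θ , 0<θ , Cθ≡½ε = quotient C ½ε 0<C 0<½ε
      N₃ , t-close = ct η 0<η
      N₄ , s-close = cs θ 0<θ
      M = N₁ ℕ.⊔ N₂
      K = N₃ ℕ.⊔ N₄
  in M ℕ.⊔ K , λ m n m≥ n≥ →
    let m≥M = ℕ.m⊔n≤o⇒m≤o M K m≥
        n≥M = ℕ.m⊔n≤o⇒m≤o M K n≥
        m≥K = ℕ.m⊔n≤o⇒n≤o M K m≥
        n≥K = ℕ.m⊔n≤o⇒n≤o M K n≥
    in subst (ℚ.∣ s m ℚ.* t m ℚ.- s n ℚ.* t n ∣ ℚ.<_)
         (trans (cong₂ ℚ._+_ Bη≡½ε Cθ≡½ε) (half ε))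
         (*-close (s m) (t m) (s n) (t n) B C η θ 0<B 0<C
           (s≤B m (ℕ.m⊔n≤o⇒m≤o N₁ N₂ m≥M)) (t≤C n (ℕ.m⊔n≤o⇒n≤o N₁ N₂ n≥M))
           (t-close m n (ℕ.m⊔n≤o⇒m≤o N₃ N₄ m≥K) (ℕ.m⊔n≤o⇒m≤o N₃ N₄ n≥K))
           (s-close m n (ℕ.m⊔n≤o⇒n≤o N₃ N₄ m≥K) (ℕ.m⊔n≤o⇒n≤o N₃ N₄ n≥K)))

private
  away⇒≢0 : ∀ {q δ} → 0ℚ ℚ.< δ → δ ℚ.≤ ℚ.∣ q ∣ → q ≢ 0ℚ
  away⇒≢0 0<δ δ≤∣q∣ refl = ℚ.<-irrefl refl (ℚ.<-≤-trans 0<δ δ≤∣q∣)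

  inv-bound : ∀ q δ D → 0ℚ ℚ.< δ → δ ℚ.* D ≡ 1ℚ → δ ℚ.≤ ℚ.∣ q ∣ → ℚ.∣ inv q ∣ ℚ.≤ D
  inv-bound q δ D 0<δ δD≡1 δ≤∣q∣ = ℚ.*-cancelʳ-≤-pos δ {{ℚ.positive 0<δ}} (begin
    ℚ.∣ inv q ∣ ℚ.* δ
      ≤⟨ ℚ.*-monoˡ-≤-nonNeg ℚ.∣ inv q ∣ {{ℚ.nonNegative (ℚ.0≤∣p∣ (inv q))}} δ≤∣q∣ ⟩
    ℚ.∣ inv q ∣ ℚ.* ℚ.∣ q ∣  ≡⟨ ℚ.∣p*q∣≡∣p∣*∣q∣ (inv q) q ⟨
    ℚ.∣ inv q ℚ.* q ∣        ≡⟨ cong ℚ.∣_∣ (inv-inverse q (away⇒≢0 0<δ δ≤∣q∣)) ⟩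
    1ℚ                       ≡⟨ δD≡1 ⟨
    δ ℚ.* D                  ≡⟨ ℚ.*-comm δ D ⟩
    D ℚ.* δ                  ∎)
    where open ℚ.≤-Reasoning

  inv-diff : ∀ p q → p ≢ 0ℚ → q ≢ 0ℚ →
    inv p ℚ.- inv q ≡ inv p ℚ.* (inv q ℚ.* (q ℚ.- p))
  inv-diff p q p≢0 q≢0 =
    trans (sym (cong₂ ℚ._-_ (ℚ.*-identityʳ (inv p)) (ℚ.*-identityʳ (inv q))))
      (trans (sym (cong₂ (λ a b → inv p ℚ.* a ℚ.- inv q ℚ.* b) (inv-inverse q q≢0) (inv-inverse p p≢0)))
        (cross (inv p) (inv q) p q))

  inv-close : ∀ p q δ D ε → 0ℚ ℚ.< δ → 0ℚ ℚ.< D → δ ℚ.* D ≡ 1ℚ →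
    δ ℚ.≤ ℚ.∣ p ∣ → δ ℚ.≤ ℚ.∣ q ∣ → ℚ.∣ q ℚ.- p ∣ ℚ.< δ ℚ.* (δ ℚ.* ε) →
    ℚ.∣ inv p ℚ.- inv q ∣ ℚ.< ε
  inv-close p q δ D ε 0<δ 0<D δD≡1 δ≤∣p∣ δ≤∣q∣ q-p< =
    subst₂ (λ x y → ℚ.∣ x ∣ ℚ.< y)
      (sym (inv-diff p q (away⇒≢0 0<δ δ≤∣p∣) (away⇒≢0 0<δ δ≤∣q∣)))
      (trans (regroup D δ ε)
        (trans (cong (λ a → a ℚ.* (a ℚ.* ε)) δD≡1)
          (trans (ℚ.*-identityˡ (1ℚ ℚ.* ε)) (ℚ.*-identityˡ ε))))
      (*-mono-abs (inv p) (inv q ℚ.* (q ℚ.- p)) D (D ℚ.* (δ ℚ.* (δ ℚ.* ε))) 0<D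
        (inv-bound p δ D 0<δ δD≡1 δ≤∣p∣)
        (*-mono-abs (inv q) (q ℚ.- p) D (δ ℚ.* (δ ℚ.* ε)) 0<D
          (inv-bound q δ D 0<δ δD≡1 δ≤∣q∣) q-p<))

inv-cauchy : ∀ s → IsCauchy s →
  (∃[ δ ] (0ℚ ℚ.< δ × ∃[ N ] ∀ n → N ℕ.≤ n → δ ℚ.≤ ℚ.∣ s n ∣)) →
  IsCauchy (λ n → inv (s n))
inv-cauchy s cs (δ , 0<δ , N , δ≤) ε 0<ε =
  let D , 0<D , δD≡1 = quotient δ 1ℚ 0<δ 0<1
      M , s-close = cs (δ ℚ.* (δ ℚ.* ε)) (*-pos 0<δ (*-pos 0<δ 0<ε))
  in N ℕ.⊔ M , λ m n m≥ n≥ →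
    inv-close (s m) (s n) δ D ε 0<δ 0<D δD≡1
      (δ≤ m (ℕ.m⊔n≤o⇒m≤o N M m≥)) (δ≤ n (ℕ.m⊔n≤o⇒m≤o N M n≥))
      (s-close n m (ℕ.m⊔n≤o⇒n≤o N M n≥) (ℕ.m⊔n≤o⇒n≤o N M m≥))

------------------------------------------------------------------------
-- Field operations

fromℚ : ℚ → ℝ
fromℚ q = mkℝ (λ _ → q) (const-cauchy q)

fromℕ : ℕ → ℝ
fromℕ n = fromℚ (+ n ℚ./ 1)

0ℝ 1ℝ : ℝ
0ℝ = fromℚ 0ℚ
1ℝ = fromℚ 1ℚ

infixl 6 _+_ _-_
infixl 7 _*_
infix  8 -_

_+_ : ℝ → ℝ → ℝ
x + y = mkℝ (λ n → seq x n ℚ.+ seq y n) (+-cauchy (seq x) (seq y) (cauchy x) (cauchy y))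

-_ : ℝ → ℝ
- x = mkℝ (λ n → ℚ.- seq x n) (neg-cauchy (seq x) (cauchy x))

_-_ : ℝ → ℝ → ℝ
x - y = x + - y

_*_ : ℝ → ℝ → ℝ
x * y = mkℝ (λ n → seq x n ℚ.* seq y n) (*-cauchy (seq x) (seq y) (cauchy x) (cauchy y))

#0⇒away : ∀ x → x # 0ℝ →
  ∃[ δ ] (0ℚ ℚ.< δ × ∃[ N ] ∀ n → N ℕ.≤ n → δ ℚ.≤ ℚ.∣ seq x n ∣)
#0⇒away x (inj₁ (mk< δ 0<δ N h)) = δ , 0<δ , N , λ n n≥ → begin
  δ                                              ≡⟨ cancelˡ (seq x n) δ ⟩
  ℚ.- seq x n ℚ.+ (seq x n ℚ.+ δ)                ≤⟨ ℚ.+-monoʳ-≤ (ℚ.- seq x n) (h n n≥) ⟩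
  ℚ.- seq x n ℚ.+ 0ℚ                             ≡⟨ ℚ.+-identityʳ (ℚ.- seq x n) ⟩
  ℚ.- seq x n                                    ≤⟨ p≤∣p∣ (ℚ.- seq x n) ⟩
  ℚ.∣ ℚ.- seq x n ∣                              ≡⟨ ℚ.∣-p∣≡∣p∣ (seq x n) ⟩
  ℚ.∣ seq x n ∣                                  ∎
  where
  open ℚ.≤-Reasoning
#0⇒away x (inj₂ (mk< δ 0<δ N h)) = δ , 0<δ , N , λ n n≥ →
  ℚ.≤-trans (subst (ℚ._≤ seq x n) (ℚ.+-identityˡ δ) (h n n≥)) (p≤∣p∣ (seq x n))

recip : (x : ℝ) → x # 0ℝ → ℝ
recip x x#0 = mkℝ (λ n → inv (seq x n)) (inv-cauchy (seq x) (cauchy x) (#0⇒away x x#0))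

recip⁺ : (x : ℝ) → 0ℝ < x → ℝ
recip⁺ x 0<x = recip x (inj₂ 0<x)

------------------------------------------------------------------------
-- Limits and series

_⟶_ : (ℕ → ℝ) → ℝ → Set
u ⟶ l = ∀ ε → 0ℝ < ε →
  ∃[ N ] ∀ n → N ℕ.≤ n → (l - ε < u n) × (u n < l + ε)

partialSum : (ℕ → ℝ) → ℕ → ℝ
partialSum u zero    = 0ℝ
partialSum u (suc m) = partialSum u m + u m

HasSum : (ℕ → ℝ) → ℝ → Set
HasSum u S = partialSum u ⟶ S

------------------------------------------------------------------------
-- Real polynomials, as coefficient lists with the constant term first.
-- Trailing zeros are allowed: equality of polynomials is _≋_.

Poly : Set
Poly = List ℝ

coeff : Poly → ℕ → ℝ
coeff []      _       = 0ℝ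
coeff (a ∷ p) zero    = a
coeff (a ∷ p) (suc i) = coeff p i

infix 4 _≋_

_≋_ : Poly → Poly → Set
p ≋ q = ∀ i → coeff p i ≈ coeff q i

constant : ℝ → Poly
constant c = c ∷ []

infixl 6 _-ₚ_

_-ₚ_ : Poly → Poly → Poly
[]      -ₚ q       = map -_ q
(a ∷ p) -ₚ []      = a ∷ p
(a ∷ p) -ₚ (b ∷ q) = (a - b) ∷ (p -ₚ q)

eval : Poly → ℝ → ℝ
eval []      x = 0ℝ
eval (a ∷ p) x = a + x * eval p x

HasDegree : Poly → ℕ → Set
HasDegree p d = (coeff p d # 0ℝ) × (∀ i → d ℕ.< i → coeff p i ≈ 0ℝ)

------------------------------------------------------------------------
-- Reciprocal sums

PositiveBeyond : Poly → ℝ → Set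
PositiveBeyond P i₀ = ∀ x → i₀ < x → 0ℝ < eval P x

i₀<suc+i₀ : ∀ i₀ j → i₀ < fromℕ (suc j) + i₀
i₀<suc+i₀ i₀ j = mk< q (ℚ.positive⁻¹ q {{ℚ.normalize-pos (suc j) 1}}) 0
  (λ n _ → ℚ.≤-reflexive (ℚ.+-comm (seq i₀ n) q))
  where q = + suc j ℚ./ 1

-- term P i₀ pos j is x_{j+1} = 1 / P (j + 1 + i₀): the indices i ≥ 1 are
-- written i = suc j.
term : (P : Poly) (i₀ : ℝ) → PositiveBeyond P i₀ → ℕ → ℝ
term P i₀ pos j =
  recip⁺ (eval P (fromℕ (suc j) + i₀)) (pos (fromℕ (suc j) + i₀) (i₀<suc+i₀ i₀ j))

-- The m-th entry of the tail is x_{n+1+m}, so its series is Σ_{i ≥ n+1} x_i.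
tail : (P : Poly) (i₀ : ℝ) → PositiveBeyond P i₀ → ℕ → ℕ → ℝ
tail P i₀ pos n m = term P i₀ pos (n ℕ.+ m)

-- Convergence of the series, to a positive sum, is part of the claim.
Approximates : Poly → Poly → Set
Approximates P f = ∀ i₀ (pos : PositiveBeyond P i₀) →
  ∃[ N₀ ] ∀ n → N₀ ℤ.≤ + n →
    ∃[ S ] HasSum (tail P i₀ pos n) S ×
      Σ[ 0<S ∈ 0ℝ < S ]
        (eval f (fromℕ n + i₀) < recip⁺ S 0<S) ×
        (recip⁺ S 0<S < eval f (fromℕ n + i₀) + 1ℝ)

{-# OPTIONS --safe #-}
module Submission where

-- With x = i + i₀ the tail sum telescopes against 1 / g for a polynomial g
-- of degree k − 1 such that D(x) = P(x + 1) (g(x + 1) − g(x)) − g(x) g(x + 1)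
-- has degree less than k − 1.  The k coefficients of g are found from the top
-- down, since changing the coefficient of x ^ j by c changes that of
-- x ^ (k − 1 + j) in D by a (j − 2 (k − 1)) c ≠ 0, where a is the leading
-- coefficient of P.  Replacing g by g ∓ ε changes D by ± 2 ε g to leading
-- order, so that eventually
--   1 / (g + ε)(x) − 1 / (g + ε)(x + 1) < 1 / P(x + 1) < 1 / (g − ε)(x) − 1 / (g − ε)(x + 1),
-- hence g − ε ≤ 1 / Σ ≤ g + ε, and f = g − ½ will do.  For uniqueness, two
-- such polynomials differ by at most 1 at all large n + i₀, and a polynomial
-- that is bounded there is constant.

open import Algebra.Bundles using (CommutativeRing)
open import Algebra.Structures using (IsCommutativeRing)
import Algebra.Solver.Ring
import Algebra.Solver.Ring.AlmostCommutativeRing as ACR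
open import Data.Empty using (⊥)
open import Data.List using (List; []; _∷_)
open import Data.Maybe using (Maybe; just; nothing)
open import Data.Nat as ℕ using (ℕ; zero; suc; _≤_; _∸_)
import Data.Nat.Properties as ℕ
open import Data.Integer as ℤ using (+_)
import Data.Integer.Properties as ℤ
open import Data.Product using (∃-syntax; Σ-syntax; _×_; _,_; proj₁; proj₂)
open import Data.Rational as ℚ using (ℚ; 0ℚ; 1ℚ; ½)
import Data.Rational.Properties as ℚ
open import Data.Rational.Solver using (module +-*-Solver)
import Data.Rational.Unnormalised as ℚᵘ
import Data.Rational.Unnormalised.Properties as ℚᵘ
open import Data.Sum using (_⊎_; inj₁; inj₂)
import Relation.Binary.Reasoning.Setoid
open import Relation.Binary.PropositionalEquality as ≡ using (_≡_)
open import Relation.Nullary using (¬_; yes; no; contradiction)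
open import Relation.Binary using (Setoid)

-- The order on the reals is not decidable constructively, and this shapes the proof. A coefficient
-- cannot be tested for zero, so degrees appear only as upper bounds together with the coefficient
-- at the bound; "degree below m" means that this coefficient is 0. The divisions that produce `g`
-- are by quantities shown to be positive. Only `<` is available: each weak bound is replaced by its
-- strict consequences, and the slack comes from choosing ε below ½. Equality of coefficients in the
-- uniqueness part is reached by refuting both strict inequalities. The leading coefficient of `g`
-- is forced: the tail of Σ 1 / (a x ^ k) behaves like 1 / ((k - 1) a x ^ (k - 1)). The shift `i₀`
-- enters only through x = n + i₀. The inequalities between `P` and `g` hold for all large real x,
-- so `f` depends on `P` alone and `i₀` only affects how large n must be. The argument is carried
-- out over an axiomatic complete ordered field, which the Cauchy reals are then shown to be.

Eventually : (ℕ → Set) → Set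
Eventually Q = ∃[ N ] ∀ n → N ≤ n → Q n

ev-map₂ : ∀ {Q R T : ℕ → Set} → (∀ n → Q n → R n → T n) →
  Eventually Q → Eventually R → Eventually T
ev-map₂ f (N , q) (M , r) = N ℕ.⊔ M , λ n n≥ →
  f n (q n (ℕ.m⊔n≤o⇒m≤o N M n≥)) (r n (ℕ.m⊔n≤o⇒n≤o N M n≥))

ev-map : ∀ {Q R : ℕ → Set} → (∀ n → Q n → R n) → Eventually Q → Eventually R
ev-map f (N , q) = N , λ n n≥ → f n (q n n≥)

ev-witness : ∀ {Q : ℕ → Set} → Eventually Q → ∃[ n ] Q n
ev-witness (N , q) = N , q N ℕ.≤-refl

inductive⇒≥ : ∀ (Q : ℕ → Set) {N} → Q N → (∀ n → Q n → Q (suc n)) → ∀ n → N ≤ n → Q n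
inductive⇒≥ Q base step n N≤n = go (ℕ.≤⇒≤′ N≤n)
  where
  go : ∀ {n} → _ ℕ.≤′ n → Q n
  go (ℕ.≤′-reflexive ≡.refl) = base
  go (ℕ.≤′-step h) = step _ (go h)

-- Natural numbers among the rationals

ℕ→ℚ : ℕ → ℚ
ℕ→ℚ n = + n ℚ./ 1

toℚᵘ-ℕ→ℚ : ∀ n → ℚ.toℚᵘ (ℕ→ℚ n) ℚᵘ.≃ ℚᵘ.mkℚᵘ (+ n) 0
toℚᵘ-ℕ→ℚ n = ℚ.toℚᵘ-fromℚᵘ (ℚᵘ.mkℚᵘ (+ n) 0)

-- Normalised addition divides by a gcd and does not compute for a variable `n`; unnormalised
-- fractions avoid this.
ℕ→ℚ-suc : ∀ n → ℕ→ℚ (suc n) ≡ ℕ→ℚ n ℚ.+ 1ℚ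
ℕ→ℚ-suc n = ℚ.toℚᵘ-injective (begin-equality
  ℚ.toℚᵘ (ℕ→ℚ (suc n))              ≃⟨ toℚᵘ-ℕ→ℚ (suc n) ⟩
  ℚᵘ.mkℚᵘ (+ suc n) 0               ≃⟨ ℚᵘ.*≡* (≡.cong (ℤ._* + 1) eq) ⟩
  ℚᵘ.mkℚᵘ (+ n) 0 ℚᵘ.+ ℚᵘ.1ℚᵘ       ≃⟨ ℚᵘ.+-congˡ ℚᵘ.1ℚᵘ (toℚᵘ-ℕ→ℚ n) ⟨
  ℚ.toℚᵘ (ℕ→ℚ n) ℚᵘ.+ ℚᵘ.1ℚᵘ        ≃⟨ ℚ.toℚᵘ-homo-+ (ℕ→ℚ n) 1ℚ ⟨
  ℚ.toℚᵘ (ℕ→ℚ n ℚ.+ 1ℚ)             ∎)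
  where
  open ℚᵘ.≤-Reasoning
  eq : + suc n ≡ (+ n) ℤ.* (+ 1) ℤ.+ + 1
  eq = ≡.sym (≡.trans (≡.cong (ℤ._+ + 1) (ℤ.*-identityʳ (+ n))) (≡.cong +_ (ℕ.+-comm n 1)))

-- The denominator is at least 1, so a nonnegative fraction is below its numerator plus 1.
ℚ-archimedean : ∀ q → ∃[ n ] q ℚ.< ℕ→ℚ n
ℚ-archimedean q@(ℚ.mkℚ (+ m) d _) = suc m , ℚ.toℚᵘ-cancel-< {q} {ℕ→ℚ (suc m)}
  (ℚᵘ.<-respʳ-≃ (ℚᵘ.≃-sym (toℚᵘ-ℕ→ℚ (suc m)))
    (ℚᵘ.*<* (≡.subst₂ ℤ._<_ (ℤ.pos-* m 1) (ℤ.pos-* (suc m) (suc d))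
      (ℤ.+<+ (ℕ.<-≤-trans (ℕ.*-monoˡ-< 1 (ℕ.n<1+n m)) (ℕ.*-monoʳ-≤ (suc m) (ℕ.s≤s ℕ.z≤n)))))))
ℚ-archimedean q@(ℚ.mkℚ ℤ.-[1+ m ] d _) = 0 , ℚ.negative⁻¹ q

-- Complete ordered fields, with the order given by positivity

record CompleteField : Set₁ where
  infix  4 _≈_ _<_ _#_
  infixl 6 _+_ _-_
  infixl 7 _*_
  infix  8 -_
  field
    Carrier : Set
    _≈_ _<_ : Carrier → Carrier → Set
    _+_ _*_ : Carrier → Carrier → Carrier
    -_      : Carrier → Carrier
    fromℚ   : ℚ → Carrier
  0# : Carrier
  0# = fromℚ 0ℚ
  1# : Carrier
  1# = fromℚ 1ℚ
  _-_ : Carrier → Carrier → Carrier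
  x - y = x + - y
  _#_ : Carrier → Carrier → Set
  x # y = x < y ⊎ y < x
  fromℕ : ℕ → Carrier
  fromℕ n = fromℚ (ℕ→ℚ n)
  _⟶_ : (ℕ → Carrier) → Carrier → Set
  u ⟶ l = ∀ ε → 0# < ε → Eventually (λ n → (l - ε < u n) × (u n < l + ε))
  -- Later terms are compared with the single pivot `u N`, by two one-sided inequalities, since
  -- there is no absolute value here.
  Cauchy : (ℕ → Carrier) → Set
  Cauchy u = ∀ ε → 0# < ε →
    ∃[ N ] ∀ n → N ≤ n → (u N < u n + ε) × (u n < u N + ε)
  field
    isCommutativeRing : IsCommutativeRing _≈_ _+_ _*_ -_ 0# 1#
    fromℚ-+   : ∀ p q → fromℚ (p ℚ.+ q) ≈ fromℚ p + fromℚ q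
    fromℚ-*   : ∀ p q → fromℚ (p ℚ.* q) ≈ fromℚ p * fromℚ q
    fromℚ-neg : ∀ p → fromℚ (ℚ.- p) ≈ - fromℚ p
    <-irrefl    : ∀ {x} → ¬ x < x
    <⇒pos       : ∀ {x y} → x < y → 0# < y - x
    pos⇒<       : ∀ {x y} → 0# < y - x → x < y
    pos-resp    : ∀ {x y} → x ≈ y → 0# < x → 0# < y
    pos-+       : ∀ {x y} → 0# < x → 0# < y → 0# < x + y
    pos-*       : ∀ {x y} → 0# < x → 0# < y → 0# < x * y
    pos-cancel  : ∀ {x y} → 0# < x → 0# < x * y → 0# < y
    pos-fromℚ   : ∀ {q} → 0ℚ ℚ.< q → 0# < fromℚ q
    #0-tight    : ∀ {x} → ¬ x # 0# → x ≈ 0#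
    archimedean : ∀ x → ∃[ n ] x < fromℕ n
    inverse     : ∀ x → 0# < x → ∃[ r ] r * x ≈ 1#
    complete    : ∀ u → Cauchy u → ∃[ l ] u ⟶ l

-- The theorem over a complete ordered field

module Theory (F : CompleteField) where
  open CompleteField F
  open IsCommutativeRing isCommutativeRing
    using (+-cong; *-cong; +-identityˡ; +-identityʳ; zeroˡ; zeroʳ; *-comm)
    renaming (refl to ≈-refl; sym to ≈-sym; trans to ≈-trans; -‿cong to neg-cong;
              reflexive to ≈-reflexive)

  commutativeRing : CommutativeRing _ _
  commutativeRing = record { isCommutativeRing = isCommutativeRing }

  fromℚ-morphism : ℚ.+-*-rawRing ACR.-Raw-AlmostCommutative⟶ ACR.fromCommutativeRing commutativeRing
  fromℚ-morphism = record
    { ⟦_⟧ = fromℚ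
    ; +-homo = fromℚ-+
    ; *-homo = fromℚ-*
    ; -‿homo = fromℚ-neg
    ; 0-homo = ≈-refl
    ; 1-homo = ≈-refl
    }

  _coeff≟_ : ∀ p q → Maybe (fromℚ p ≈ fromℚ q)
  p coeff≟ q with p ℚ.≟ q
  ... | yes p≡q = just (≈-reflexive (≡.cong fromℚ p≡q))
  ... | no _ = nothing

  open Algebra.Solver.Ring ℚ.+-*-rawRing (ACR.fromCommutativeRing commutativeRing)
    fromℚ-morphism _coeff≟_ using (solve; _:=_; _:+_; _:*_; _:-_; :-_; con)
  open Relation.Binary.Reasoning.Setoid (CommutativeRing.setoid commutativeRing)

  -- Inequalities are proved by exhibiting the difference of the two
  -- sides as a positive combination of known positive quantities.
  pos⇒<-by : ∀ {x y z} → 0# < z → z ≈ y - x → x < y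
  pos⇒<-by 0<z eq = pos⇒< (pos-resp eq 0<z)

  <-trans : ∀ {x y z} → x < y → y < z → x < z
  <-trans {x} {y} {z} x<y y<z = pos⇒<-by (pos-+ (<⇒pos x<y) (<⇒pos y<z))
    (solve 3 (λ x y z → (y :- x) :+ (z :- y) := z :- x) ≈-refl x y z)

  <-respˡ : ∀ {x x′ y} → x ≈ x′ → x < y → x′ < y
  <-respˡ eq h = pos⇒<-by (<⇒pos h) (+-cong ≈-refl (neg-cong eq))

  <-respʳ : ∀ {x y y′} → y ≈ y′ → x < y → x < y′
  <-respʳ eq h = pos⇒<-by (<⇒pos h) (+-cong eq ≈-refl)

  0<1# : 0# < 1#
  0<1# = pos-fromℚ (ℚ.positive⁻¹ 1ℚ)

  0<½# : 0# < fromℚ ½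
  0<½# = pos-fromℚ (ℚ.positive⁻¹ ½)

  fromℕ-suc : ∀ n → fromℕ (suc n) ≈ fromℕ n + 1#
  fromℕ-suc n = ≈-trans (≈-reflexive (≡.cong fromℚ (ℕ→ℚ-suc n))) (fromℚ-+ (ℕ→ℚ n) 1ℚ)

  fromℕ-<-suc : ∀ n → fromℕ n < fromℕ (suc n)
  fromℕ-<-suc n = pos⇒<-by 0<1# (≈-trans (solve 1 (λ a → con 1ℚ := (a :+ con 1ℚ) :- a) ≈-refl (fromℕ n))
    (+-cong (≈-sym (fromℕ-suc n)) ≈-refl))

  fromℕ-< : ∀ {m n} → m ℕ.< n → fromℕ m < fromℕ n
  fromℕ-< {m} = inductive⇒≥ (λ n → fromℕ m < fromℕ n) (fromℕ-<-suc m)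
    (λ n h → <-trans h (fromℕ-<-suc n)) _

  fromℕ-≤-< : ∀ {m n x} → m ≤ n → fromℕ n < x → fromℕ m < x
  fromℕ-≤-< m≤n n<x with ℕ.m≤n⇒m<n∨m≡n m≤n
  ... | inj₁ m<n = <-trans (fromℕ-< m<n) n<x
  ... | inj₂ ≡.refl = n<x

  translates-exceed : ∀ X y → Eventually (λ n → X < fromℕ n + y)
  translates-exceed X y =
    let N , X-y<N = archimedean (X - y)
        base = pos⇒<-by (<⇒pos X-y<N)
          (solve 3 (λ n x y → n :- (x :- y) := (n :+ y) :- x) ≈-refl (fromℕ N) X y)
    in N , inductive⇒≥ (λ n → X < fromℕ n + y) base (λ n h → <-trans h
         (pos⇒<-by (<⇒pos (fromℕ-<-suc n))
           (solve 3 (λ m n y → m :- n := (m :+ y) :- (n :+ y)) ≈-refl (fromℕ (suc n)) (fromℕ n) y)))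

  pos-inverse : ∀ {x r} → 0# < x → r * x ≈ 1# → 0# < r
  pos-inverse {x} {r} 0<x rx≈1 =
    pos-cancel 0<x (pos-resp (≈-trans (≈-sym rx≈1) (*-comm r x)) 0<1#)

  -- The difference `r - s` is `r * s * (y - x)`. Positivity is asked of the inverses, which suits
  -- both directions: from numbers to reciprocals and back.
  inverse-antitone : ∀ {x y r s} → r * x ≈ 1# → s * y ≈ 1# → 0# < r → 0# < s → x < y → s < r
  inverse-antitone {x} {y} {r} {s} rx≈1 sy≈1 0<r 0<s x<y =
    pos⇒<-by (pos-* (pos-* 0<r 0<s) (<⇒pos x<y)) (begin
      (r * s) * (y - x)
        ≈⟨ solve 4 (λ x y r s → (r :* s) :* (y :- x) := r :* (s :* y) :- s :* (r :* x)) ≈-refl x y r s ⟩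
      r * (s * y) - s * (r * x)
        ≈⟨ +-cong (*-cong ≈-refl sy≈1) (neg-cong (*-cong ≈-refl rx≈1)) ⟩
      r * 1# - s * 1#
        ≈⟨ solve 2 (λ r s → r :* con 1ℚ :- s :* con 1ℚ := r :- s) ≈-refl r s ⟩
      r - s ∎)

  -- Polynomials as coefficient lists, constant term first

  Poly : Set
  Poly = List Carrier

  coeff : Poly → ℕ → Carrier
  coeff []      _       = 0#
  coeff (a ∷ p) zero    = a
  coeff (a ∷ p) (suc i) = coeff p i

  eval : Poly → Carrier → Carrier
  eval []      x = 0#
  eval (a ∷ p) x = a + x * eval p x

  infixl 6 _⊞_
  infixl 7 _⊡_ _⊠_

  _⊞_ : Poly → Poly → Poly
  []      ⊞ q       = q
  (a ∷ p) ⊞ []      = a ∷ p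
  (a ∷ p) ⊞ (b ∷ q) = (a + b) ∷ (p ⊞ q)

  _⊡_ : Carrier → Poly → Poly
  c ⊡ []      = []
  c ⊡ (a ∷ p) = c * a ∷ c ⊡ p

  _⊠_ : Poly → Poly → Poly
  []      ⊠ q = []
  (a ∷ p) ⊠ q = a ⊡ q ⊞ (0# ∷ p ⊠ q)

  -- The forward difference p(X + 1) − p(X).
  Δ : Poly → Poly
  Δ []      = []
  Δ (a ∷ p) = p ⊞ (Δ p ⊞ (0# ∷ Δ p))

  coeff-⊞ : ∀ p q i → coeff (p ⊞ q) i ≈ coeff p i + coeff q i
  coeff-⊞ []      q       i       = ≈-sym (+-identityˡ (coeff q i))
  coeff-⊞ (a ∷ p) []      i       = ≈-sym (+-identityʳ (coeff (a ∷ p) i))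
  coeff-⊞ (a ∷ p) (b ∷ q) zero    = ≈-refl
  coeff-⊞ (a ∷ p) (b ∷ q) (suc i) = coeff-⊞ p q i

  coeff-⊡ : ∀ c p i → coeff (c ⊡ p) i ≈ c * coeff p i
  coeff-⊡ c []      i       = ≈-sym (zeroʳ c)
  coeff-⊡ c (a ∷ p) zero    = ≈-refl
  coeff-⊡ c (a ∷ p) (suc i) = coeff-⊡ c p i

  eval-cong : ∀ p {x y} → x ≈ y → eval p x ≈ eval p y
  eval-cong []      x≈y = ≈-refl
  eval-cong (a ∷ p) x≈y = +-cong ≈-refl (*-cong x≈y (eval-cong p x≈y))

  eval-⊞ : ∀ p q x → eval (p ⊞ q) x ≈ eval p x + eval q x
  eval-⊞ []      q       x = ≈-sym (+-identityˡ (eval q x))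
  eval-⊞ (a ∷ p) []      x = ≈-sym (+-identityʳ (eval (a ∷ p) x))
  eval-⊞ (a ∷ p) (b ∷ q) x = ≈-trans (+-cong ≈-refl (*-cong ≈-refl (eval-⊞ p q x)))
    (solve 5 (λ a b x u v → (a :+ b) :+ x :* (u :+ v) := (a :+ x :* u) :+ (b :+ x :* v))
      ≈-refl a b x (eval p x) (eval q x))

  eval-⊡ : ∀ c p x → eval (c ⊡ p) x ≈ c * eval p x
  eval-⊡ c []      x = ≈-sym (zeroʳ c)
  eval-⊡ c (a ∷ p) x = ≈-trans (+-cong ≈-refl (*-cong ≈-refl (eval-⊡ c p x)))
    (solve 4 (λ c a x u → c :* a :+ x :* (c :* u) := c :* (a :+ x :* u)) ≈-refl c a x (eval p x))

  eval-⊠ : ∀ p q x → eval (p ⊠ q) x ≈ eval p x * eval q x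
  eval-⊠ []      q x = ≈-sym (zeroˡ (eval q x))
  eval-⊠ (a ∷ p) q x = begin
    eval (a ⊡ q ⊞ (0# ∷ p ⊠ q)) x              ≈⟨ eval-⊞ (a ⊡ q) (0# ∷ p ⊠ q) x ⟩
    eval (a ⊡ q) x + (0# + x * eval (p ⊠ q) x)
      ≈⟨ +-cong (eval-⊡ a q x) (+-cong ≈-refl (*-cong ≈-refl (eval-⊠ p q x))) ⟩
    a * eval q x + (0# + x * (eval p x * eval q x))
      ≈⟨ solve 4 (λ a x u v → a :* v :+ (con 0ℚ :+ x :* (u :* v)) := (a :+ x :* u) :* v)
           ≈-refl a x (eval p x) (eval q x) ⟩
    (a + x * eval p x) * eval q x ∎

  eval-Δ : ∀ p x → eval (Δ p) x ≈ eval p (x + 1#) - eval p x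
  eval-Δ []      x = solve 0 (con 0ℚ := con 0ℚ :- con 0ℚ) ≈-refl
  eval-Δ (a ∷ p) x = begin
    eval (p ⊞ (Δ p ⊞ (0# ∷ Δ p))) x              ≈⟨ eval-⊞ p (Δ p ⊞ (0# ∷ Δ p)) x ⟩
    eval p x + eval (Δ p ⊞ (0# ∷ Δ p)) x         ≈⟨ +-cong ≈-refl (eval-⊞ (Δ p) (0# ∷ Δ p) x) ⟩
    eval p x + (eval (Δ p) x + (0# + x * eval (Δ p) x))
      ≈⟨ +-cong ≈-refl (+-cong (eval-Δ p x) (+-cong ≈-refl (*-cong ≈-refl (eval-Δ p x)))) ⟩
    eval p x + ((u - eval p x) + (0# + x * (u - eval p x)))
      ≈⟨ solve 4 (λ a x v u → v :+ ((u :- v) :+ (con 0ℚ :+ x :* (u :- v))) :=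
                               (a :+ (x :+ con 1ℚ) :* u) :- (a :+ x :* v)) ≈-refl a x (eval p x) u ⟩
    (a + (x + 1#) * u) - (a + x * eval p x) ∎
    where u = eval p (x + 1#)

  -- Degree bounds and leading coefficients

  Null : Poly → Set
  Null p = ∀ i → coeff p i ≈ 0#

  -- The number a may vanish: m only bounds the degree.
  Lead : Poly → ℕ → Carrier → Set
  Lead p m a = coeff p m ≈ a × (∀ i → m ℕ.< i → coeff p i ≈ 0#)

  0+0≈0 : ∀ {x y} → x ≈ 0# → y ≈ 0# → x + y ≈ 0#
  0+0≈0 x≈0 y≈0 = ≈-trans (+-cong x≈0 y≈0) (+-identityˡ 0#)

  *0≈0 : ∀ x {y} → y ≈ 0# → x * y ≈ 0#
  *0≈0 x y≈0 = ≈-trans (*-cong ≈-refl y≈0) (zeroʳ x)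

  null-⊞ : ∀ p q → Null p → Null q → Null (p ⊞ q)
  null-⊞ p q hp hq i = ≈-trans (coeff-⊞ p q i) (0+0≈0 (hp i) (hq i))

  null-0∷ : ∀ p → Null p → Null (0# ∷ p)
  null-0∷ p h zero    = ≈-refl
  null-0∷ p h (suc i) = h i

  null-tail : ∀ {a p} → Null (a ∷ p) → Null p
  null-tail h i = h (suc i)

  lead-0-tail : ∀ {a b p} → Lead (a ∷ p) 0 b → Null p
  lead-0-tail (_ , h) i = h (suc i) (ℕ.s≤s ℕ.z≤n)

  lead-tail : ∀ {a b p m} → Lead (a ∷ p) (suc m) b → Lead p m b
  lead-tail (l , h) = l , λ i m<i → h (suc i) (ℕ.s≤s m<i)

  lead-[] : ∀ {m a} → Lead [] m a → a ≈ 0#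
  lead-[] (0≈a , _) = ≈-sym 0≈a

  null-⊠ : ∀ p q → Null p → Null (p ⊠ q)
  null-⊠ []      q h i = ≈-refl
  null-⊠ (a ∷ p) q h = null-⊞ (a ⊡ q) (0# ∷ p ⊠ q)
    (λ i → ≈-trans (coeff-⊡ a q i) (≈-trans (*-cong (h 0) ≈-refl) (zeroˡ (coeff q i))))
    (null-0∷ (p ⊠ q) (null-⊠ p q (null-tail {a} {p} h)))

  null-Δ : ∀ p → Null p → Null (Δ p)
  null-Δ []      h = h
  null-Δ (a ∷ p) h = null-⊞ p (Δ p ⊞ (0# ∷ Δ p)) p≋0 (null-⊞ (Δ p) (0# ∷ Δ p) Δp≋0 (null-0∷ (Δ p) Δp≋0))
    where
    p≋0 = null-tail {a} {p} h
    Δp≋0 = null-Δ p p≋0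

  eval-null : ∀ p x → Null p → eval p x ≈ 0#
  eval-null []      x h = ≈-refl
  eval-null (a ∷ p) x h = 0+0≈0 (h 0) (*0≈0 x (eval-null p x (null-tail {a} {p} h)))

  lead-⊞ : ∀ {m a b} p q → Lead p m a → Lead q m b → Lead (p ⊞ q) m (a + b)
  lead-⊞ {m} p q (lp , hp) (lq , hq) =
    ≈-trans (coeff-⊞ p q m) (+-cong lp lq) ,
    λ i m<i → ≈-trans (coeff-⊞ p q i) (0+0≈0 (hp i m<i) (hq i m<i))

  lead-⊡ : ∀ {m a} c p → Lead p m a → Lead (c ⊡ p) m (c * a)
  lead-⊡ {m} c p (l , h) =
    ≈-trans (coeff-⊡ c p m) (*-cong ≈-refl l) ,
    λ i m<i → ≈-trans (coeff-⊡ c p i) (*0≈0 c (h i m<i))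

  -- The source of the value `0#`: lower-order contributions are raised to the common bound `n`,
  -- where they add nothing.
  lead-weaken : ∀ {m n a} p → m ℕ.< n → Lead p m a → Lead p n 0#
  lead-weaken {n = n} p m<n (_ , h) = h n m<n , λ i n<i → h i (ℕ.<-trans m<n n<i)

  lead-∷ : ∀ {m a} c p → Lead p m a → Lead (c ∷ p) (suc m) a
  lead-∷ c p (l , h) = l , λ { (suc i) (ℕ.s≤s m<i) → h i m<i }

  lead-resp : ∀ {m a b} p → a ≈ b → Lead p m a → Lead p m b
  lead-resp p a≈b (l , h) = ≈-trans l a≈b , h

  null⇒lead : ∀ m p → Null p → Lead p m 0#
  null⇒lead m p h = h m , λ i _ → h i

  lead-⊠ : ∀ {m n a b} p q → Lead p m a → Lead q n b → Lead (p ⊠ q) (m ℕ.+ n) (a * b)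
  lead-⊠ {m} {n} {a} {b} [] q lp lq = lead-resp []
    (≈-sym (≈-trans (*-cong (lead-[] {m} lp) ≈-refl) (zeroˡ b))) (null⇒lead (m ℕ.+ n) [] (λ _ → ≈-refl))
  lead-⊠ {zero} {n} {a} {b} (c ∷ p) q lp lq = lead-resp (c ⊡ q ⊞ (0# ∷ p ⊠ q))
    (≈-trans (+-identityʳ (c * b)) (*-cong (proj₁ lp) ≈-refl))
    (lead-⊞ (c ⊡ q) (0# ∷ p ⊠ q) (lead-⊡ c q lq)
      (null⇒lead n (0# ∷ p ⊠ q) (null-0∷ (p ⊠ q) (null-⊠ p q (lead-0-tail {c} {a} {p} lp)))))
  lead-⊠ {suc m} {n} {a} {b} (c ∷ p) q lp lq = lead-resp (c ⊡ q ⊞ (0# ∷ p ⊠ q)) (+-identityˡ (a * b))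
    (lead-⊞ (c ⊡ q) (0# ∷ p ⊠ q)
      (lead-weaken (c ⊡ q) (ℕ.s≤s (ℕ.m≤n+m n m)) (lead-⊡ c q lq))
      (lead-∷ 0# (p ⊠ q) (lead-⊠ p q (lead-tail {c} {a} {p} lp) lq)))

  lead-0⇒null-Δ : ∀ {a} p → Lead p 0 a → Null (Δ p)
  lead-0⇒null-Δ [] l i = ≈-refl
  lead-0⇒null-Δ {a} (c ∷ p) l = null-⊞ p (Δ p ⊞ (0# ∷ Δ p)) p≋0
    (null-⊞ (Δ p) (0# ∷ Δ p) (null-Δ p p≋0) (null-0∷ (Δ p) (null-Δ p p≋0)))
    where p≋0 = lead-0-tail {c} {a} {p} l

  -- In Horner form the difference of `c + X p` is `p + Δ p + X Δ p`. Of these, `p` contributes `a`,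
  -- `X Δ p` contributes the earlier multiple of `a`, and `Δ p` has lower degree.
  lead-Δ : ∀ {m a} p → Lead p (suc m) a → Lead (Δ p) m (fromℕ (suc m) * a)
  lead-Δ {m} {a} [] l = lead-resp [] (≈-sym (*0≈0 (fromℕ (suc m)) (lead-[] {suc m} l)))
    (null⇒lead m [] (λ _ → ≈-refl))
  lead-Δ {zero} {a} (c ∷ p) l = lead-resp (Δ (c ∷ p))
    (solve 1 (λ a → a :+ con 0ℚ := con 1ℚ :* a) ≈-refl a)
    (lead-⊞ p (Δ p ⊞ (0# ∷ Δ p)) lp
      (null⇒lead 0 (Δ p ⊞ (0# ∷ Δ p)) (null-⊞ (Δ p) (0# ∷ Δ p) Δp≋0 (null-0∷ (Δ p) Δp≋0))))
    where
    lp = lead-tail {c} {a} {p} l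
    Δp≋0 : Null (Δ p)
    Δp≋0 = lead-0⇒null-Δ p lp
  lead-Δ {suc m} {a} (c ∷ p) l = lead-resp (Δ (c ∷ p))
    (≈-trans (solve 2 (λ a n → a :+ (con 0ℚ :+ n :* a) := (n :+ con 1ℚ) :* a) ≈-refl a (fromℕ (suc m)))
      (*-cong (≈-sym (fromℕ-suc (suc m))) ≈-refl))
    (lead-⊞ p (Δ p ⊞ (0# ∷ Δ p)) lp
      (lead-⊞ (Δ p) (0# ∷ Δ p) (lead-weaken (Δ p) (ℕ.n<1+n m) lΔp) (lead-∷ 0# (Δ p) lΔp)))
    where
    lp = lead-tail {c} {a} {p} l
    lΔp = lead-Δ p lp

  -- Values at large arguments

  eval-lead-0 : ∀ {a} p x → Lead p 0 a → eval p x ≈ a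
  eval-lead-0     []      x (0≈a , _) = 0≈a
  eval-lead-0 {a} (c ∷ p) x l@(c≈a , _) = ≈-trans
    (+-cong c≈a (*0≈0 x (eval-null p x (lead-0-tail {c} {a} {p} l)))) (+-identityʳ a)

  -- Induction along the Horner form `c + x * p`. A bound `δ` away from 0 is carried instead of bare
  -- positivity: it makes `x * p` outgrow `- c`. Thresholds are natural numbers, so that their
  -- maximum can be taken.
  eventually-bounded-below : ∀ m {a} p → Lead p m a → 0# < a →
    ∃[ X ] ∃[ δ ] (0# < δ × ∀ x → fromℕ X < x → δ < eval p x)
  eventually-bounded-below zero {a} p l 0<a = 0 , fromℚ ½ * a , pos-* 0<½# 0<a , λ x _ →
    <-respʳ (≈-sym (eval-lead-0 p x l)) (pos⇒<-by (pos-* 0<½# 0<a)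
      (solve 1 (λ a → con ½ :* a := a :- con ½ :* a) ≈-refl a))
  eventually-bounded-below (suc m) {a} [] l 0<a =
    contradiction (pos-resp (lead-[] {suc m} l) 0<a) <-irrefl
  eventually-bounded-below (suc m) {a} (c ∷ p) l 0<a =
    let X , δ , 0<δ , δ<p = eventually-bounded-below m p (lead-tail {c} {a} {p} l) 0<a
        r , rδ≈1 = inverse δ 0<δ
        -- Beyond `(1 - c) / δ` one has `x * δ > 1 - c`, hence `c + x * p > 1`.
        M , [1-c]r<M = archimedean ((1# - c) * r)
    in X ℕ.⊔ M , 1# , 0<1# , λ x x>X⊔M →
      let x>X = fromℕ-≤-< (ℕ.m≤m⊔n X M) x>X⊔M
          x>M = fromℕ-≤-< (ℕ.m≤n⊔m X M) x>X⊔M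
          0<x = fromℕ-≤-< {0} {X} ℕ.z≤n x>X
          y = eval p x
          n = fromℕ M
      in pos⇒<-by (pos-+ (pos-+ (pos-* 0<x (<⇒pos (δ<p x x>X))) (pos-* (<⇒pos x>M) 0<δ))
                         (pos-* (<⇒pos [1-c]r<M) 0<δ)) (begin
        (x * (y - δ) + (x - n) * δ) + (n - (1# - c) * r) * δ
          ≈⟨ solve 6 (λ x y d n c r →
               (x :* (y :- d) :+ (x :- n) :* d) :+ (n :- (con 1ℚ :- c) :* r) :* d
               := x :* y :- (con 1ℚ :- c) :* (r :* d)) ≈-refl x y δ n c r ⟩
        x * y - (1# - c) * (r * δ)
          ≈⟨ +-cong ≈-refl (neg-cong (*-cong ≈-refl rδ≈1)) ⟩
        x * y - (1# - c) * 1#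
          ≈⟨ solve 3 (λ x y c → x :* y :- (con 1ℚ :- c) :* con 1ℚ := (c :+ x :* y) :- con 1ℚ)
               ≈-refl x y c ⟩
        (c + x * y) - 1# ∎)

  -- Polynomial functions with a degree bound

  HasLead : (Carrier → Carrier) → ℕ → Carrier → Set
  HasLead F m a = ∃[ p ] Lead p m a × (∀ x → eval p x ≈ F x)

  -- Degrees are attached to functions and not to lists so that any identity of values, such as one
  -- found by the ring solver, transports them.
  hasLead-resp : ∀ {F G m a b} → (∀ x → F x ≈ G x) → a ≈ b → HasLead F m a → HasLead G m b
  hasLead-resp F≈G a≈b (p , l , e) = p , lead-resp p a≈b l , λ x → ≈-trans (e x) (F≈G x)

  hasLead-+ : ∀ {F G m a b} → HasLead F m a → HasLead G m b → HasLead (λ x → F x + G x) m (a + b)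
  hasLead-+ (p , lp , ep) (q , lq , eq) =
    p ⊞ q , lead-⊞ p q lp lq , λ x → ≈-trans (eval-⊞ p q x) (+-cong (ep x) (eq x))

  hasLead-· : ∀ {F m a} c → HasLead F m a → HasLead (λ x → c * F x) m (c * a)
  hasLead-· c (p , l , e) = c ⊡ p , lead-⊡ c p l , λ x → ≈-trans (eval-⊡ c p x) (*-cong ≈-refl (e x))

  hasLead-neg : ∀ {F m a} → HasLead F m a → HasLead (λ x → - F x) m (- a)
  hasLead-neg {F} {a = a} h = hasLead-resp (λ x → -1* (F x)) (-1* a) (hasLead-· (- 1#) h)
    where
    -1* : ∀ y → (- 1#) * y ≈ - y
    -1* = solve 1 (λ y → (:- con 1ℚ) :* y := :- y) ≈-refl

  hasLead-- : ∀ {F G m a b} → HasLead F m a → HasLead G m b → HasLead (λ x → F x - G x) m (a - b)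
  hasLead-- f g = hasLead-+ f (hasLead-neg g)

  hasLead-* : ∀ {F G m n a b} → HasLead F m a → HasLead G n b →
    HasLead (λ x → F x * G x) (m ℕ.+ n) (a * b)
  hasLead-* (p , lp , ep) (q , lq , eq) =
    p ⊠ q , lead-⊠ p q lp lq , λ x → ≈-trans (eval-⊠ p q x) (*-cong (ep x) (eq x))

  hasLead-weaken : ∀ {F m n a} → m ℕ.< n → HasLead F m a → HasLead F n 0#
  hasLead-weaken m<n (p , l , e) = p , lead-weaken p m<n l , e

  hasLead-const : ∀ c → HasLead (λ _ → c) 0 c
  hasLead-const c = c ∷ [] , (≈-refl , λ { (suc i) _ → ≈-refl }) ,
    λ x → ≈-trans (+-cong ≈-refl (zeroʳ x)) (+-identityʳ c)

  hasLead-monomial : ∀ c m → Σ[ F ∈ (Carrier → Carrier) ] HasLead F m c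
  hasLead-monomial c zero = _ , hasLead-const c
  hasLead-monomial c (suc m) = let F , p , l , e = hasLead-monomial c m in
    eval (0# ∷ p) , 0# ∷ p , lead-∷ 0# p l , λ x → ≈-refl

  hasLead-zero : ∀ {F} m → (∀ x → F x ≈ 0#) → HasLead F m 0#
  hasLead-zero m F≈0 = [] , (≈-refl , λ _ _ → ≈-refl) , λ x → ≈-sym (F≈0 x)

  -- The shift adds `Δ p`, whose degree is smaller, so the leading coefficient survives.
  hasLead-shift : ∀ {F m a} → HasLead F m a → HasLead (λ x → F (x + 1#)) m a
  hasLead-shift {F} {m} {a} (p , l , e) = p ⊞ Δ p , lead-resp (p ⊞ Δ p) (+-identityʳ a)
      (lead-⊞ p (Δ p) l (Δ-lower m l)) , λ x → begin
    eval (p ⊞ Δ p) x                              ≈⟨ eval-⊞ p (Δ p) x ⟩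
    eval p x + eval (Δ p) x                       ≈⟨ +-cong ≈-refl (eval-Δ p x) ⟩
    eval p x + (eval p (x + 1#) - eval p x)
      ≈⟨ solve 2 (λ u v → u :+ (v :- u) := v) ≈-refl (eval p x) (eval p (x + 1#)) ⟩
    eval p (x + 1#)                               ≈⟨ e (x + 1#) ⟩
    F (x + 1#) ∎
    where
    Δ-lower : ∀ m → Lead p m a → Lead (Δ p) m 0#
    Δ-lower zero    l = null⇒lead 0 (Δ p) (lead-0⇒null-Δ p l)
    Δ-lower (suc m) l = lead-weaken (Δ p) (ℕ.n<1+n m) (lead-Δ p l)

  -- Writing the degree of `A` as a successor turns `(m + 1) + (j - 1)` into `m + j` without
  -- subtraction. At `j = 0` the difference is zero, in accordance with the factor `fromℕ j`.
  hasLead-*Δ : ∀ {A F m a c} j → HasLead A (suc m) a → HasLead F j c →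
    HasLead (λ x → A x * (F (x + 1#) - F x)) (m ℕ.+ j) (a * (fromℕ j * c))
  hasLead-*Δ {A} {F} {m} {a} {c} zero hA (p , l , e) =
    hasLead-resp (λ _ → ≈-refl) (solve 2 (λ a c → con 0ℚ := a :* (con 0ℚ :* c)) ≈-refl a c)
      (hasLead-zero (m ℕ.+ 0) λ x → *0≈0 (A x) (begin
        F (x + 1#) - F x            ≈⟨ +-cong (e (x + 1#)) (neg-cong (e x)) ⟨
        eval p (x + 1#) - eval p x  ≈⟨ eval-Δ p x ⟨
        eval (Δ p) x                ≈⟨ eval-null (Δ p) x (lead-0⇒null-Δ p l) ⟩
        0#                          ∎))
  hasLead-*Δ {A} {F} {m} {a} {c} (suc j) hA (p , l , e) rewrite ℕ.+-suc m j =
    hasLead-resp (λ x → *-cong ≈-refl (≈-trans (eval-Δ p x) (+-cong (e (x + 1#)) (neg-cong (e x)))))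
      ≈-refl (hasLead-* hA (Δ p , lead-Δ p l , λ _ → ≈-refl))

  -- Once the coefficient at the bound is known to vanish, the next one becomes visible; it is what
  -- `improve` has to cancel.
  hasLead-drop : ∀ {F m} → HasLead F (suc m) 0# → ∃[ c ] HasLead F m c
  hasLead-drop {F} {m} (p , (l , h) , e) = coeff p m , p , (≈-refl , above) , e
    where
    above : ∀ i → m ℕ.< i → coeff p i ≈ 0#
    above i m<i with ℕ.m≤n⇒m<n∨m≡n m<i
    ... | inj₁ 1+m<i  = h i 1+m<i
    ... | inj₂ ≡.refl = l

  eventually-pos : ∀ {F m a} → HasLead F m a → 0# < a → ∃[ X ] ∀ x → fromℕ X < x → 0# < F x
  eventually-pos {m = m} (p , l , e) 0<a =
    let X , δ , 0<δ , δ<p = eventually-bounded-below m p l 0<a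
    in X , λ x x>X → pos-resp (e x) (<-trans 0<δ (δ<p x x>X))

  -- The degree bound is positive, so subtracting the constant `B` does not touch the leading
  -- coefficient.
  diverges : ∀ {F m a} → HasLead F (suc m) a → 0# < a → ∀ B → ∃[ X ] ∀ x → fromℕ X < x → B < F x
  diverges {F} {m} {a} h 0<a B =
    let X , 0<F-B = eventually-pos (hasLead-- h (hasLead-weaken (ℕ.s≤s ℕ.z≤n) (hasLead-const B)))
          (pos-resp (solve 1 (λ a → a := a :- con 0ℚ) ≈-refl a) 0<a)
    in X , λ x x>X → pos⇒< (0<F-B x x>X)

  -- The polynomial g, coefficient by coefficient

  -- 1 / G(x) − 1 / G(x + 1) = 1 / A(x) amounts to the vanishing of the defect.
  defect : (A G : Carrier → Carrier) → Carrier → Carrier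
  defect A G x = A x * (G (x + 1#) - G x) - G x * G (x + 1#)

  module ApproximateSolution (K₁ : ℕ) {A : Carrier → Carrier} {a : Carrier}
    (hA : HasLead A (suc (suc K₁)) a) (0<a : 0# < a) where

    K : ℕ
    K = suc K₁

    -- The coefficient of `x ^ (2 K)` in the defect of `b x ^ K + ...` is `a * K * b - b * b`; this
    -- is its nonzero root.
    b : Carrier
    b = fromℕ K * a

    0<fromℕ-K : 0# < fromℕ K
    0<fromℕ-K = fromℕ-< {0} {K} (ℕ.s≤s ℕ.z≤n)

    0<b : 0# < b
    0<b = pos-* 0<fromℕ-K 0<a

    -- Adding h = c x ^ j to G changes the coefficient of x ^ (K + j) in the
    -- defect by − (2 b − a j) c, and leaves the higher ones alone.
    improve : ∀ j {G} → j ℕ.< K → HasLead G K b → HasLead (defect A G) (K ℕ.+ suc j) 0# →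
      ∃[ G′ ] HasLead G′ K b × HasLead (defect A G′) (K ℕ.+ j) 0#
    improve j {G} j<K hG hD =
      let d , hD′ = hasLead-drop (≡.subst (λ n → HasLead (defect A G) n 0#) (ℕ.+-suc K j) hD)
          e = (b + b) - a * fromℕ j
          0<e = pos-resp (solve 3 (λ a k j → a :* ((k :- j) :+ k) := (k :* a :+ k :* a) :- a :* j)
                  ≈-refl a (fromℕ K) (fromℕ j))
                (pos-* 0<a (pos-+ (<⇒pos (fromℕ-< j<K)) 0<fromℕ-K))
          r , re≈1 = inverse e 0<e
          -- The quotient `d / e`, so that the coefficient `d - e * c` vanishes.
          c = d * r
          H , hH = hasLead-monomial c j
          G′ = λ x → G x + H x
          -- The defect is quadratic in `G`: adding `H` contributes `A` times the difference of `H`,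
          -- two mixed products and `- H(x) H(x + 1)`. The last has degree at most `2 j`, which is
          -- less than `K + j`.
          hD″ = hasLead-resp
            (λ x → solve 5 (λ A g g′ h h′ →
                ((((A :* (g′ :- g) :- g :* g′) :+ A :* (h′ :- h)) :- g :* h′) :- g′ :* h) :- h :* h′
                := A :* ((g′ :+ h′) :- (g :+ h)) :- (g :+ h) :* (g′ :+ h′))
              ≈-refl (A x) (G x) (G (x + 1#)) (H x) (H (x + 1#)))
            (begin
              (((d + a * (fromℕ j * c)) - b * c) - b * c) - 0#
                ≈⟨ solve 5 (λ d r a b j →
                     (((d :+ a :* (j :* (d :* r))) :- b :* (d :* r)) :- b :* (d :* r)) :- con 0ℚ
                     := d :- d :* (r :* ((b :+ b) :- a :* j))) ≈-refl d r a b (fromℕ j) ⟩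
              d - d * (r * e)   ≈⟨ +-cong ≈-refl (neg-cong (*-cong ≈-refl re≈1)) ⟩
              d - d * 1#        ≈⟨ solve 1 (λ d → d :- d :* con 1ℚ := con 0ℚ) ≈-refl d ⟩
              0#                ∎)
            (hasLead-- (hasLead-- (hasLead-- (hasLead-+ hD′ (hasLead-*Δ j hA hH))
                (hasLead-* hG (hasLead-shift hH)))
                (hasLead-* (hasLead-shift hG) hH))
                (hasLead-weaken (ℕ.+-monoˡ-< j j<K) (hasLead-* hH (hasLead-shift hH))))
      in G′ , hasLead-resp (λ _ → ≈-refl) (+-identityʳ b) (hasLead-+ hG (hasLead-weaken j<K hH)) , hD″

    -- Here `j` is the exponent of the last coefficient fixed so far, and the defect has degree
    -- below `K + j`. It descends from `K` while `i` counts the corrections made.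
    reduce : ∀ i j → i ℕ.+ j ≡ K → ∃[ G ] HasLead G K b × HasLead (defect A G) (K ℕ.+ j) 0#
    -- The start is `b x ^ K`: by the choice of `b`, the defect already has degree below `2 K`.
    reduce zero j ≡.refl = let G , hG = hasLead-monomial b K in G , hG ,
      hasLead-resp (λ _ → ≈-refl)
        (solve 2 (λ a k → a :* (k :* (k :* a)) :- (k :* a) :* (k :* a) := con 0ℚ) ≈-refl a (fromℕ K))
        (hasLead-- (hasLead-*Δ K hA hG) (hasLead-* hG (hasLead-shift hG)))
    reduce (suc i) j eq = let G , hG , hD = reduce i (suc j) (≡.trans (ℕ.+-suc i j) eq) in
      improve j (ℕ.≤-trans (ℕ.s≤s (ℕ.m≤n+m j i)) (ℕ.≤-reflexive eq)) hG hD

    solution : ∃[ G ] HasLead G K b × HasLead (defect A G) K 0#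
    solution = let G , hG , hD = reduce K 0 (ℕ.+-identityʳ K) in
      G , hG , ≡.subst (λ n → HasLead (defect A G) n 0#) (ℕ.+-identityʳ K) hD

  -- Series compared with telescoping sums

  partialSum : (ℕ → Carrier) → ℕ → Carrier
  partialSum t zero    = 0#
  partialSum t (suc m) = partialSum t m + t m

  HasSum : (ℕ → Carrier) → Carrier → Set
  HasSum t S = partialSum t ⟶ S

  -- One-sided, being applied to positive sequences.
  Vanishes : (ℕ → Carrier) → Set
  Vanishes r = ∀ ε → 0# < ε → Eventually (λ n → r n < ε)

  vanishes-inverse : ∀ {u r : ℕ → Carrier} → (∀ n → r n * u n ≈ 1#) → (∀ n → 0# < r n) →
    (∀ B → Eventually (λ n → B < u n)) → Vanishes r
  vanishes-inverse {u} {r} ru≈1 0<r B<u ε 0<ε = let ρ , ρε≈1 = inverse ε 0<ε in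
    ev-map (λ n ρ<u → inverse-antitone (≈-trans (*-comm ε ρ) ρε≈1) (ru≈1 n) 0<ε (0<r n) ρ<u) (B<u ρ)

  -- The factor `r * r′ * t` is `1 / (u u′ α)`. Dividing the defect by `u u′ α` gives
  -- `1 / u - 1 / u′ - 1 / α`, so the sign of the defect decides how a term compares with a
  -- telescoping step.
  inverse-step : ∀ {u u′ α r r′ t} → r * u ≈ 1# → r′ * u′ ≈ 1# → t * α ≈ 1# →
    (r * r′ * t) * (α * (u′ - u) - u * u′) ≈ (r - r′) - t
  inverse-step {u} {u′} {α} {r} {r′} {t} ru≈1 r′u′≈1 tα≈1 = begin
    (r * r′ * t) * (α * (u′ - u) - u * u′)
      ≈⟨ solve 6 (λ u u′ α r r′ t →
           (r :* r′ :* t) :* (α :* (u′ :- u) :- u :* u′)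
           := (r :* ((r′ :* u′) :* (t :* α)) :- r′ :* ((r :* u) :* (t :* α)))
              :- t :* ((r :* u) :* (r′ :* u′))) ≈-refl u u′ α r r′ t ⟩
    (r * ((r′ * u′) * (t * α)) - r′ * ((r * u) * (t * α))) - t * ((r * u) * (r′ * u′))
      ≈⟨ +-cong (+-cong (*-cong ≈-refl (*-cong r′u′≈1 tα≈1))
                        (neg-cong (*-cong ≈-refl (*-cong ru≈1 tα≈1))))
                (neg-cong (*-cong ≈-refl (*-cong ru≈1 r′u′≈1))) ⟩
    (r * (1# * 1#) - r′ * (1# * 1#)) - t * (1# * 1#)
      ≈⟨ solve 3 (λ r r′ t → (r :* (con 1ℚ :* con 1ℚ) :- r′ :* (con 1ℚ :* con 1ℚ))
           :- t :* (con 1ℚ :* con 1ℚ) := (r :- r′) :- t) ≈-refl r r′ t ⟩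
    (r - r′) - t ∎

  step-upper : ∀ {u u′ α r r′ t} → r * u ≈ 1# → r′ * u′ ≈ 1# → t * α ≈ 1# →
    0# < r → 0# < r′ → 0# < t → 0# < α * (u′ - u) - u * u′ → t < r - r′
  step-upper ru≈1 r′u′≈1 tα≈1 0<r 0<r′ 0<t h =
    pos⇒<-by (pos-* (pos-* (pos-* 0<r 0<r′) 0<t) h) (inverse-step ru≈1 r′u′≈1 tα≈1)

  step-lower : ∀ {u u′ α r r′ t} → r * u ≈ 1# → r′ * u′ ≈ 1# → t * α ≈ 1# →
    0# < r → 0# < r′ → 0# < t → 0# < u * u′ - α * (u′ - u) → r - r′ < t
  step-lower {u} {u′} {α} {r} {r′} {t} ru≈1 r′u′≈1 tα≈1 0<r 0<r′ 0<t h =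
    pos⇒<-by (pos-* (pos-* (pos-* 0<r 0<r′) 0<t) h) (begin
      (r * r′ * t) * (u * u′ - α * (u′ - u))
        ≈⟨ solve 3 (λ c x y → c :* (x :- y) := :- (c :* (y :- x))) ≈-refl
             (r * r′ * t) (u * u′) (α * (u′ - u)) ⟩
      - ((r * r′ * t) * (α * (u′ - u) - u * u′))
        ≈⟨ neg-cong (inverse-step ru≈1 r′u′≈1 tα≈1) ⟩
      - ((r - r′) - t)
        ≈⟨ solve 2 (λ x t → :- (x :- t) := t :- x) ≈-refl (r - r′) t ⟩
      t - (r - r′) ∎)

  module UpperTelescope {t r : ℕ → Carrier} (t<r-r′ : ∀ m → t m < r m - r (suc m))
    (0<r : ∀ m → 0# < r m) where

    s : ℕ → Carrier
    s = partialSum t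

    -- Monotonicity is phrased as persistence of strict upper bounds, since there is no weak order.
    s+r-decreasing : ∀ {c} m → s m + r m < c → s (suc m) + r (suc m) < c
    s+r-decreasing m h = <-trans (pos⇒<-by (<⇒pos (t<r-r′ m))
      (solve 4 (λ s t r r′ → (r :- r′) :- t := (s :+ r) :- ((s :+ t) :+ r′)) ≈-refl
        (s m) (t m) (r m) (r (suc m)))) h

    s<s+r : ∀ m → s m < s m + r m
    s<s+r m = pos⇒<-by (0<r m) (solve 2 (λ s r → r := (s :+ r) :- s) ≈-refl (s m) (r m))

    -- For `n` from `N` on, `s n` lies between `s N` and `s N + r N`, because `s` increases and
    -- `s + r` decreases. A threshold for `r` is thus a Cauchy threshold for `s`.
    has-sum : (∀ m → 0# < t m) → Vanishes r → ∃[ S ] HasSum t S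
    has-sum 0<t r→0 = complete s λ ε 0<ε →
      let N , r<ε = r→0 ε 0<ε
      in N , λ n N≤n →
        inductive⇒≥ (λ n → s N < s n + ε)
          (pos⇒<-by 0<ε (solve 2 (λ s e → e := (s :+ e) :- s) ≈-refl (s N) ε))
          (λ n h → <-trans h (pos⇒<-by (0<t n)
            (solve 3 (λ s t e → t := ((s :+ t) :+ e) :- (s :+ e)) ≈-refl (s n) (t n) ε))) n N≤n ,
        <-trans (s<s+r n) (inductive⇒≥ (λ n → s n + r n < s N + ε)
          (pos⇒<-by (<⇒pos (r<ε N ℕ.≤-refl))
            (solve 3 (λ s r e → e :- r := (s :+ e) :- (s :+ r)) ≈-refl (s N) (r N) ε))
          s+r-decreasing n N≤n)

    -- Partial sums stay below `r 0`, so the limit is at most `r 0`; this weak bound is expressed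
    -- through the numbers `c` beyond `r 0`.
    sum-below : ∀ {S c} → HasSum t S → r 0 < c → S < c
    sum-below {S} {c} s→S r₀<c =
      -- From `S < s n + ε` and `s n < r 0 + ε`, where `2 ε = c - r 0`.
      let ε = fromℚ ½ * (c - r 0)
          0<ε = pos-* 0<½# (<⇒pos r₀<c)
          n , S-ε<s , _ = ev-witness (s→S ε 0<ε)
          s+r<r₀+ε = inductive⇒≥ (λ n → s n + r n < r 0 + ε)
            (pos⇒<-by 0<ε (solve 2 (λ r e → e := (r :+ e) :- (con 0ℚ :+ r)) ≈-refl (r 0) ε))
            s+r-decreasing n ℕ.z≤n
      in pos⇒<-by (pos-+ (<⇒pos S-ε<s) (<⇒pos (<-trans (s<s+r n) s+r<r₀+ε)))
           (solve 4 (λ S s r c → (s :- (S :- con ½ :* (c :- r))) :+ ((r :+ con ½ :* (c :- r)) :- s)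
              := c :- S) ≈-refl S (s n) (r 0) c)

  module LowerTelescope {t q : ℕ → Carrier} (q-q′<t : ∀ m → q m - q (suc m) < t m)
    (q→0 : Vanishes q) where

    s : ℕ → Carrier
    s = partialSum t

    sum-above : ∀ {S c} → HasSum t S → c < q 0 → c < S
    sum-above {S} {c} s→S c<q₀ =
      -- Three errors add up to `q 0 - c`: the slack in `q 0 - ε < s n + q n`, the remainder `q n`,
      -- and the distance from `s n` to `S`.
      let ⅓ = + 1 ℚ./ 3
          ε = fromℚ ⅓ * (q 0 - c)
          0<ε = pos-* (pos-fromℚ (ℚ.positive⁻¹ ⅓)) (<⇒pos c<q₀)
          n , (_ , s<S+ε) , q<ε = ev-witness (ev-map₂ (λ _ → _,_) (s→S ε 0<ε) (q→0 ε 0<ε))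
          q₀-ε<s+q = inductive⇒≥ (λ n → q 0 - ε < s n + q n)
            (pos⇒<-by 0<ε (solve 2 (λ q e → e := (con 0ℚ :+ q) :- (q :- e)) ≈-refl (q 0) ε))
            (λ m h → <-trans h (pos⇒<-by (<⇒pos (q-q′<t m))
              (solve 4 (λ s t q q′ → t :- (q :- q′) := ((s :+ t) :+ q′) :- (s :+ q)) ≈-refl
                (s m) (t m) (q m) (q (suc m))))) n ℕ.z≤n
      in pos⇒<-by (pos-+ (pos-+ (<⇒pos q₀-ε<s+q) (<⇒pos q<ε)) (<⇒pos s<S+ε))
           (solve 5 (λ S s q q₀ c →
              (((s :+ q) :- (q₀ :- con ⅓ :* (q₀ :- c))) :+ (con ⅓ :* (q₀ :- c) :- q))
                :+ ((S :+ con ⅓ :* (q₀ :- c)) :- s)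
              := S :- c) ≈-refl S (s n) (q n) (q 0) c)

  limit-unique : ∀ {u S S′} → u ⟶ S → u ⟶ S′ → ¬ S < S′
  limit-unique {u} {S} {S′} u→S u→S′ S<S′ =
    let ε = fromℚ ½ * (S′ - S)
        0<ε = pos-* 0<½# (<⇒pos S<S′)
        n , (_ , u<S+ε) , (S′-ε<u , _) = ev-witness (ev-map₂ (λ _ → _,_) (u→S ε 0<ε) (u→S′ ε 0<ε))
    in <-irrefl (<-respˡ (solve 2 (λ S S′ → S′ :- con ½ :* (S′ :- S) := S :+ con ½ :* (S′ :- S))
         ≈-refl S S′) (<-trans S′-ε<u u<S+ε))

  -- Reciprocals enter only through the equations that define them: `t` and `R` are arbitrary
  -- inverses. The statement thus applies to any construction of reciprocals, in particular to one
  -- that carries a positivity proof.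
  Approximates : Poly → Poly → Carrier → ℕ → Set
  Approximates p f i₀ n = ∀ t →
    (∀ m → t m * eval p (fromℕ (suc (n ℕ.+ m)) + i₀) ≈ 1#) → (∀ m → 0# < t m) →
    ∃[ S ] HasSum t S × 0# < S × ∀ R → R * S ≈ 1# →
      eval f (fromℕ n + i₀) < R × R < eval f (fromℕ n + i₀) + 1#

  -- Existence of f

  module Existence (K₁ : ℕ) {a : Carrier} (p : Poly) (lp : Lead p (suc (suc K₁)) a) (0<a : 0# < a) where

    A : Carrier → Carrier
    A x = eval p (x + 1#)

    open ApproximateSolution K₁ {A} (hasLead-shift (p , lp , λ _ → ≈-refl)) 0<a public

    g : Poly
    g = proj₁ (proj₁ (proj₂ solution))

    γ : Carrier → Carrier
    γ = eval g

    lead-g : Lead g K b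
    lead-g = proj₁ (proj₂ (proj₁ (proj₂ solution)))

    hasLead-γ : HasLead γ K b
    hasLead-γ = g , lead-g , λ _ → ≈-refl

    hasLead-defect : HasLead (defect A γ) K 0#
    hasLead-defect =
      let G , (_ , _ , γ≈G) , hD = solution
          G≈γ = λ x → ≈-sym (γ≈G x)
      in hasLead-resp (λ x → +-cong (*-cong ≈-refl (+-cong (G≈γ (x + 1#)) (neg-cong (G≈γ x))))
           (neg-cong (*-cong (G≈γ x) (G≈γ (x + 1#))))) ≈-refl hD

    -- Any number strictly between 0 and ½ would serve: `γ - ½ < γ - ε` and `γ + ε < γ + ½` then
    -- leave room on both sides.
    ε : Carrier
    ε = fromℚ (+ 1 ℚ./ 4)

    0<ε : 0# < ε
    0<ε = pos-fromℚ (ℚ.positive⁻¹ (+ 1 ℚ./ 4))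

    0<ε[b+b] : 0# < ε * (b + b)
    0<ε[b+b] = pos-* 0<ε (pos-+ 0<b 0<b)

    hasLead-ε : HasLead (λ x → ε * (γ x + γ (x + 1#))) K (ε * (b + b))
    hasLead-ε = hasLead-· ε (hasLead-+ hasLead-γ (hasLead-shift hasLead-γ))

    -- Constants are negligible at degree `K` because `K ≥ 1`, that is, because P has degree at
    -- least 2.
    hasLead-ε² : HasLead (λ x → ε * ε) K 0#
    hasLead-ε² = hasLead-weaken (ℕ.s≤s ℕ.z≤n) (hasLead-const (ε * ε))

    -- These two say that 1 / (γ − ε) decreases faster, and 1 / (γ + ε) slower, than the sum.
    upper-pos : ∃[ X ] ∀ x → fromℕ X < x →
      0# < A x * ((γ (x + 1#) - ε) - (γ x - ε)) - (γ x - ε) * (γ (x + 1#) - ε)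
    upper-pos = eventually-pos
      (hasLead-resp (λ x → solve 4 (λ A g g′ e →
           (A :* (g′ :- g) :- g :* g′) :+ (e :* (g :+ g′) :- e :* e)
           := A :* ((g′ :- e) :- (g :- e)) :- (g :- e) :* (g′ :- e)) ≈-refl (A x) (γ x) (γ (x + 1#)) ε)
         (solve 1 (λ c → con 0ℚ :+ (c :- con 0ℚ) := c) ≈-refl (ε * (b + b)))
         (hasLead-+ hasLead-defect (hasLead-- hasLead-ε hasLead-ε²)))
      0<ε[b+b]

    lower-pos : ∃[ X ] ∀ x → fromℕ X < x →
      0# < (γ x + ε) * (γ (x + 1#) + ε) - A x * ((γ (x + 1#) + ε) - (γ x + ε))
    lower-pos = eventually-pos
      (hasLead-resp (λ x → solve 4 (λ A g g′ e →
           (e :* (g :+ g′) :+ e :* e) :- (A :* (g′ :- g) :- g :* g′)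
           := (g :+ e) :* (g′ :+ e) :- A :* ((g′ :+ e) :- (g :+ e))) ≈-refl (A x) (γ x) (γ (x + 1#)) ε)
         (solve 1 (λ c → (c :+ con 0ℚ) :- con 0ℚ := c) ≈-refl (ε * (b + b)))
         (hasLead-- (hasLead-+ hasLead-ε hasLead-ε²) hasLead-defect))
      0<ε[b+b]

    -- The bound 1 exceeds both `ε` and ½, which makes `γ - ε` and `γ - ½` positive, hence
    -- invertible.
    1<γ : ∃[ X ] ∀ x → fromℕ X < x → 1# < γ x
    1<γ = diverges hasLead-γ 0<b 1#

    f : Poly
    f = g ⊞ (fromℚ (ℚ.- ½) ∷ [])

    lead-f : Lead f K b
    lead-f = lead-resp f (+-identityʳ b)
      (lead-⊞ g (fromℚ (ℚ.- ½) ∷ []) lead-g (≈-refl , λ { (suc i) _ → ≈-refl }))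

    eval-f : ∀ x → eval f x ≈ γ x - fromℚ ½
    eval-f x = ≈-trans (eval-⊞ g (fromℚ (ℚ.- ½) ∷ []) x)
      (solve 2 (λ g x → g :+ (con (ℚ.- ½) :+ x :* con 0ℚ) := g :- con ½) ≈-refl (γ x) x)

    X : ℕ
    X = (proj₁ upper-pos ℕ.⊔ proj₁ lower-pos) ℕ.⊔ proj₁ 1<γ

    module Tail (i₀ : Carrier) (n : ℕ) (X<x : ∀ k → n ≤ k → fromℕ X < fromℕ k + i₀)
      (t : ℕ → Carrier) (tα≈1 : ∀ m → t m * eval p (fromℕ (suc (n ℕ.+ m)) + i₀) ≈ 1#)
      (0<t : ∀ m → 0# < t m) where

      y : ℕ → Carrier
      y m = fromℕ (n ℕ.+ m) + i₀

      α : ℕ → Carrier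
      α m = eval p (fromℕ (suc (n ℕ.+ m)) + i₀)

      X<y : ∀ m → fromℕ X < y m
      X<y m = X<x (n ℕ.+ m) (ℕ.m≤m+n n m)

      next : ∀ m → fromℕ (suc (n ℕ.+ m)) + i₀ ≈ y m + 1#
      next m = ≈-trans (+-cong (fromℕ-suc (n ℕ.+ m)) ≈-refl)
        (solve 2 (λ k i → (k :+ con 1ℚ) :+ i := (k :+ i) :+ con 1ℚ) ≈-refl (fromℕ (n ℕ.+ m)) i₀)

      y-suc : ∀ m → y m + 1# ≈ y (suc m)
      y-suc m = ≈-trans (≈-sym (next m))
        (+-cong (≈-reflexive (≡.cong fromℕ (≡.sym (ℕ.+-suc n m)))) ≈-refl)

      γ-suc : ∀ m → γ (y m + 1#) ≈ γ (y (suc m))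
      γ-suc m = eval-cong g (y-suc m)

      A≈α : ∀ m → A (y m) ≈ α m
      A≈α m = eval-cong p (≈-sym (next m))

      1<γy : ∀ m → 1# < γ (y m)
      1<γy m = proj₂ 1<γ (y m) (fromℕ-≤-<
        (ℕ.m≤n⊔m (proj₁ upper-pos ℕ.⊔ proj₁ lower-pos) (proj₁ 1<γ)) (X<y m))

      γ→∞ : ∀ B → Eventually (λ m → B < γ (y m))
      γ→∞ B =
        let Z , B<γ = diverges hasLead-γ 0<b B
            M , Z<x = translates-exceed (fromℕ Z) i₀
        in M , λ m M≤m → B<γ (y m) (Z<x (n ℕ.+ m) (ℕ.≤-trans M≤m (ℕ.m≤n+m m n)))

      u v : ℕ → Carrier
      u m = γ (y m) - ε
      v m = γ (y m) + ε

      0<u : ∀ m → 0# < u m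
      0<u m = pos-resp
        (solve 1 (λ g → (g :- con 1ℚ) :+ con (+ 3 ℚ./ 4) := g :- con (+ 1 ℚ./ 4)) ≈-refl (γ (y m)))
        (pos-+ (<⇒pos (1<γy m)) (pos-fromℚ (ℚ.positive⁻¹ (+ 3 ℚ./ 4))))

      0<v : ∀ m → 0# < v m
      0<v m = pos-+ (<-trans 0<1# (1<γy m)) 0<ε

      r q : ℕ → Carrier
      r m = proj₁ (inverse (u m) (0<u m))
      q m = proj₁ (inverse (v m) (0<v m))

      ru≈1 : ∀ m → r m * u m ≈ 1#
      ru≈1 m = proj₂ (inverse (u m) (0<u m))

      qv≈1 : ∀ m → q m * v m ≈ 1#
      qv≈1 m = proj₂ (inverse (v m) (0<v m))

      0<r : ∀ m → 0# < r m
      0<r m = pos-inverse (0<u m) (ru≈1 m)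

      0<q : ∀ m → 0# < q m
      0<q m = pos-inverse (0<v m) (qv≈1 m)

      r→0 : Vanishes r
      r→0 = vanishes-inverse ru≈1 0<r λ B → ev-map (λ m h → pos⇒<-by (<⇒pos h)
        (solve 3 (λ B g e → g :- (B :+ e) := (g :- e) :- B) ≈-refl B (γ (y m)) ε)) (γ→∞ (B + ε))

      q→0 : Vanishes q
      q→0 = vanishes-inverse qv≈1 0<q λ B → ev-map (λ m h → <-trans h (pos⇒<-by 0<ε
        (solve 2 (λ g e → e := (g :+ e) :- g) ≈-refl (γ (y m)) ε))) (γ→∞ B)

      t<r-r′ : ∀ m → t m < r m - r (suc m)
      t<r-r′ m = step-upper (ru≈1 m) (ru≈1 (suc m)) (tα≈1 m) (0<r m) (0<r (suc m)) (0<t m)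
        (pos-resp (+-cong (*-cong (A≈α m) (+-cong (+-cong (γ-suc m) ≈-refl) ≈-refl))
                          (neg-cong (*-cong ≈-refl (+-cong (γ-suc m) ≈-refl))))
          (proj₂ upper-pos (y m) (fromℕ-≤-< (ℕ.≤-trans (ℕ.m≤m⊔n (proj₁ upper-pos) (proj₁ lower-pos))
            (ℕ.m≤m⊔n _ (proj₁ 1<γ))) (X<y m))))

      q-q′<t : ∀ m → q m - q (suc m) < t m
      q-q′<t m = step-lower (qv≈1 m) (qv≈1 (suc m)) (tα≈1 m) (0<q m) (0<q (suc m)) (0<t m)
        (pos-resp (+-cong (*-cong ≈-refl (+-cong (γ-suc m) ≈-refl))
                          (neg-cong (*-cong (A≈α m) (+-cong (+-cong (γ-suc m) ≈-refl) ≈-refl))))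
          (proj₂ lower-pos (y m) (fromℕ-≤-< (ℕ.≤-trans (ℕ.m≤n⊔m (proj₁ upper-pos) (proj₁ lower-pos))
            (ℕ.m≤m⊔n _ (proj₁ 1<γ))) (X<y m))))

      module U = UpperTelescope t<r-r′ 0<r
      module L = LowerTelescope q-q′<t q→0

      φ : Carrier
      φ = eval f (fromℕ n + i₀)

      φ≈ : φ ≈ γ (y 0) - fromℚ ½
      φ≈ = ≈-trans (eval-f (fromℕ n + i₀)) (+-cong (eval-cong g (+-cong
        (≈-reflexive (≡.cong fromℕ (≡.sym (ℕ.+-identityʳ n)))) ≈-refl)) ≈-refl)

      φ<u : φ < u 0
      φ<u = <-respˡ (≈-sym φ≈) (pos⇒<-by 0<ε (solve 1
        (λ g → con (+ 1 ℚ./ 4) := (g :- con (+ 1 ℚ./ 4)) :- (g :- con ½)) ≈-refl (γ (y 0))))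

      v<φ+1 : v 0 < φ + 1#
      v<φ+1 = <-respʳ (+-cong (≈-sym φ≈) ≈-refl) (pos⇒<-by 0<ε (solve 1
        (λ g → con (+ 1 ℚ./ 4) := ((g :- con ½) :+ con 1ℚ) :- (g :+ con (+ 1 ℚ./ 4))) ≈-refl (γ (y 0))))

      0<φ : 0# < φ
      0<φ = pos-resp (≈-sym φ≈) (pos-resp
        (solve 1 (λ g → (g :- con 1ℚ) :+ con ½ := g :- con ½) ≈-refl (γ (y 0)))
        (pos-+ (<⇒pos (1<γy 0)) 0<½#))

      claim : ∃[ S ] HasSum t S × 0# < S × ∀ R → R * S ≈ 1# → φ < R × R < φ + 1#
      claim =
        let S , t→S = U.has-sum 0<t r→0
            0<φ+1 = pos-+ 0<φ 0<1#
            ρ , ρφ≈1 = inverse φ 0<φ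
            σ , σ[φ+1]≈1 = inverse (φ + 1#) 0<φ+1
            0<ρ = pos-inverse 0<φ ρφ≈1
            0<σ = pos-inverse 0<φ+1 σ[φ+1]≈1
            -- The strict inequality `φ < u 0` puts `r 0` strictly below `ρ = 1 / φ`, as `sum-below`
            -- demands; `v 0 < φ + 1` plays the same part for `sum-above`.
            S<ρ = U.sum-below t→S (inverse-antitone ρφ≈1 (ru≈1 0) 0<ρ (0<r 0) φ<u)
            σ<S = L.sum-above t→S (inverse-antitone (qv≈1 0) σ[φ+1]≈1 (0<q 0) 0<σ v<φ+1)
            0<S = <-trans 0<σ σ<S
        in S , t→S , 0<S , λ R RS≈1 → let 0<R = pos-inverse 0<S RS≈1 in
          inverse-antitone RS≈1 (≈-trans (*-comm φ ρ) ρφ≈1) 0<R 0<φ S<ρ ,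
          inverse-antitone (≈-trans (*-comm (φ + 1#) σ) σ[φ+1]≈1) RS≈1 0<φ+1 0<R σ<S

    approximates : ∀ i₀ → Eventually (Approximates p f i₀)
    approximates i₀ = let N , X<x = translates-exceed (fromℕ X) i₀ in
      N , λ n N≤n → Tail.claim i₀ n λ k n≤k → X<x k (ℕ.≤-trans N≤n n≤k)

  existence : ∀ K₁ {a} p → Lead p (suc (suc K₁)) a → 0# < a →
    ∃[ f ] (∃[ b ] 0# < b × Lead f (suc K₁) b) × (∀ i₀ → Eventually (Approximates p f i₀))
  existence K₁ p lp 0<a = f , (b , 0<b , lead-f) , approximates
    where open Existence K₁ p lp 0<a

  -- Uniqueness up to the constant term

  module Uniqueness (i₀ : Carrier) where

    -- The weak inequality `q ≤ p + 1` at all late points, in negated form. It holds both ways when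
    -- the unit intervals above `p` and `q` share a point.
    NoGap : Poly → Poly → Set
    NoGap p q = Eventually (λ n → ¬ eval p (fromℕ n + i₀) + 1# < eval q (fromℕ n + i₀))

    coeff-diff : ∀ p q i → coeff (q ⊞ (- 1#) ⊡ p) i ≈ coeff q i - coeff p i
    coeff-diff p q i = ≈-trans (coeff-⊞ q ((- 1#) ⊡ p) i)
      (≈-trans (+-cong ≈-refl (coeff-⊡ (- 1#) p i))
        (solve 2 (λ a b → b :+ (:- con 1ℚ) :* a := b :- a) ≈-refl (coeff p i) (coeff q i)))

    eval-diff : ∀ p q x → eval (q ⊞ (- 1#) ⊡ p) x ≈ eval q x - eval p x
    eval-diff p q x = ≈-trans (eval-⊞ q ((- 1#) ⊡ p) x)
      (≈-trans (+-cong ≈-refl (eval-⊡ (- 1#) p x))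
        (solve 2 (λ a b → b :+ (:- con 1ℚ) :* a := b :- a) ≈-refl (eval p x) (eval q x)))

    gap : ∀ p q x → 1# < eval (q ⊞ (- 1#) ⊡ p) x → eval p x + 1# < eval q x
    gap p q x 1<d = pos⇒<-by (<⇒pos (<-respʳ (eval-diff p q x) 1<d))
      (solve 2 (λ a b → (b :- a) :- con 1ℚ := b :- (a :+ con 1ℚ)) ≈-refl (eval p x) (eval q x))

    lead-diff : ∀ p q i → (∀ j → i ℕ.< j → coeff p j ≈ coeff q j) →
      Lead (q ⊞ (- 1#) ⊡ p) i (coeff q i - coeff p i)
    lead-diff p q i above = coeff-diff p q i , λ j i<j →
      ≈-trans (coeff-diff p q j) (≈-trans (+-cong (≈-sym (above j i<j)) ≈-refl)
        (solve 1 (λ a → a :- a := con 0ℚ) ≈-refl (coeff p j)))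

    -- Otherwise `q - p` would have a positive leading coefficient in the positive degree `suc i`,
    -- hence would eventually exceed 1.
    noGap⇒¬< : ∀ p q i → NoGap p q → (∀ j → suc i ℕ.< j → coeff p j ≈ coeff q j) →
      ¬ coeff p (suc i) < coeff q (suc i)
    noGap⇒¬< p q i noGap above p<q =
      let d = q ⊞ (- 1#) ⊡ p
          X , 1<d = diverges (d , lead-diff p q (suc i) above , λ _ → ≈-refl) (<⇒pos p<q) 1#
          gaps = ev-map (λ n X<x → gap p q (fromℕ n + i₀) (1<d (fromℕ n + i₀) X<x))
            (translates-exceed (fromℕ X) i₀)
          _ , ⊥-now = ev-witness (ev-map₂ {T = λ _ → ⊥} (λ _ no yes → no yes) noGap gaps)
      in ⊥-now

    -- Agreement spreads from the top coefficient down. Both signs of a difference are refuted, and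
    -- tightness of apartness turns this into equality.
    coeffs-agree : ∀ p q K → (∀ i → K ℕ.< i → coeff p i ≈ 0#) → (∀ i → K ℕ.< i → coeff q i ≈ 0#) →
      NoGap p q → NoGap q p → ∀ i → coeff p (suc i) ≈ coeff q (suc i)
    coeffs-agree p q K hp hq pq qp i = agree K i (ℕ.≤-trans (ℕ.n<1+n K) (ℕ.m≤n+m (suc K) i))
      where
      -- Induction on `k` with `K ≤ i + k`. At `k = 0` both polynomials vanish above `suc i`;
      -- otherwise the smaller `k` covers all higher coefficients.
      agree : ∀ k i → K ℕ.< i ℕ.+ suc k → coeff p (suc i) ≈ coeff q (suc i)
      agree k i K<i+1+k = begin
        P             ≈⟨ solve 2 (λ a b → a := (a :- b) :+ b) ≈-refl P Q ⟩
        (P - Q) + Q   ≈⟨ +-cong (#0-tight λ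
          { (inj₁ P-Q<0) → noGap⇒¬< p q i pq (above k K<i+1+k) (pos⇒<-by (<⇒pos P-Q<0)
              (solve 2 (λ a b → con 0ℚ :- (a :- b) := b :- a) ≈-refl P Q))
          ; (inj₂ 0<P-Q) → noGap⇒¬< q p i qp (λ j i<j → ≈-sym (above k K<i+1+k j i<j)) (pos⇒< 0<P-Q)
          }) ≈-refl ⟩
        0# + Q        ≈⟨ +-identityˡ Q ⟩
        Q             ∎
        where
        P = coeff p (suc i)
        Q = coeff q (suc i)
        above : ∀ k → K ℕ.< i ℕ.+ suc k → ∀ j → suc i ℕ.< j → coeff p j ≈ coeff q j
        above zero K<i+1 j 1+i<j = ≈-trans (hp j K<j) (≈-sym (hq j K<j))
          where
          K<j : K ℕ.< j
          K<j = ℕ.<-trans (ℕ.<-≤-trans K<i+1 (ℕ.≤-reflexive (ℕ.+-comm i 1))) 1+i<j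
        above (suc k) K<i+2+k (suc j) (ℕ.s≤s i<j) = agree k j (ℕ.<-≤-trans K<i+2+k
          (ℕ.≤-trans (ℕ.≤-reflexive (ℕ.+-suc i (suc k))) (ℕ.+-monoˡ-≤ (suc k) i<j)))

  -- Each approximation brings its own sum of the same series. From `R′ < x + 1 < y < R` it would
  -- follow that `S < S′`, against uniqueness of limits.
  noGap-between : ∀ {t S S′ R R′ x y} → HasSum t S → HasSum t S′ → R * S ≈ 1# → R′ * S′ ≈ 1# →
    0# < S → 0# < S′ → y < R → R′ < x + 1# → ¬ x + 1# < y
  noGap-between {S = S} {S′} {R} {R′} t→S t→S′ RS≈1 R′S′≈1 0<S 0<S′ y<R R′<x+1 x+1<y =
    limit-unique t→S t→S′ (inverse-antitone (≈-trans (*-comm S′ R′) R′S′≈1) (≈-trans (*-comm S R) RS≈1)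
      0<S′ 0<S (<-trans R′<x+1 (<-trans x+1<y y<R)))

-- The Cauchy reals as a complete ordered field

open import Defs
open +-*-Solver using (solve; _:=_; _:+_; _:*_; _:-_; :-_; con)
-- Rational arithmetic

0<½ : 0ℚ ℚ.< ½
0<½ = ℚ.positive⁻¹ ½

0<1 : 0ℚ ℚ.< 1ℚ
0<1 = ℚ.positive⁻¹ 1ℚ

ℚ*-pos : ∀ p q → 0ℚ ℚ.< p → 0ℚ ℚ.< q → 0ℚ ℚ.< p ℚ.* q
ℚ*-pos p q 0<p 0<q =
  ℚ.positive⁻¹ (p ℚ.* q) {{ℚ.pos*pos⇒pos p {{ℚ.positive 0<p}} q {{ℚ.positive 0<q}}}}

ℚ+-pos : ∀ p q → 0ℚ ℚ.< p → 0ℚ ℚ.< q → 0ℚ ℚ.< p ℚ.+ q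
ℚ+-pos p q 0<p 0<q = ℚ.+-mono-< {0ℚ} {p} {0ℚ} {q} 0<p 0<q

½-pos : ∀ {ε} → 0ℚ ℚ.< ε → 0ℚ ℚ.< ½ ℚ.* ε
½-pos {ε} = ℚ*-pos ½ ε 0<½

halves : ∀ ε → ½ ℚ.* ε ℚ.+ ½ ℚ.* ε ≡ ε
halves ε = ≡.trans (≡.sym (ℚ.*-distribʳ-+ ε ½ ½)) (ℚ.*-identityˡ ε)

ℚ-quotient : ∀ {B ε} → 0ℚ ℚ.< B → 0ℚ ℚ.< ε → ∃[ η ] (0ℚ ℚ.< η × B ℚ.* η ≡ ε)
ℚ-quotient {B} {ε} 0<B 0<ε = η ℚ.* ε , ℚ*-pos η ε 0<η 0<ε ,
  ≡.trans (≡.sym (ℚ.*-assoc B η ε)) (≡.trans (≡.cong (ℚ._* ε) (ℚ.*-inverseʳ B)) (ℚ.*-identityˡ ε))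
  where
  instance
    B-pos : ℚ.Positive B
    B-pos = ℚ.positive 0<B
    B-nonZero : ℚ.NonZero B
    B-nonZero = ℚ.pos⇒nonZero B
  η = ℚ.1/ B
  0<η : 0ℚ ℚ.< η
  0<η = ℚ.positive⁻¹ η {{ℚ.1/pos⇒pos B}}

0≤-⇒≤ : ∀ {p q} → 0ℚ ℚ.≤ q ℚ.- p → p ℚ.≤ q
0≤-⇒≤ {p} {q} h = ≡.subst₂ ℚ._≤_ (ℚ.+-identityʳ p)
  (solve 2 (λ p q → p :+ (q :- p) := q) ≡.refl p q) (ℚ.+-monoʳ-≤ p h)

≤⇒0≤- : ∀ {p q} → p ℚ.≤ q → 0ℚ ℚ.≤ q ℚ.- p
≤⇒0≤- {p} {q} h = ≡.subst (ℚ._≤ q ℚ.- p) (ℚ.+-inverseʳ p) (ℚ.+-monoˡ-≤ (ℚ.- p) h)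

p≤∣p∣ : ∀ p → p ℚ.≤ ℚ.∣ p ∣
p≤∣p∣ p with ℚ.≤-total 0ℚ p
... | inj₁ 0≤p = ℚ.≤-reflexive (≡.sym (ℚ.0≤p⇒∣p∣≡p 0≤p))
... | inj₂ p≤0 = ℚ.≤-trans p≤0 (ℚ.0≤∣p∣ p)

-p≤∣p∣ : ∀ p → ℚ.- p ℚ.≤ ℚ.∣ p ∣
-p≤∣p∣ p = ≡.subst (ℚ.- p ℚ.≤_) (ℚ.∣-p∣≡∣p∣ p) (p≤∣p∣ (ℚ.- p))

∣∣<-intro : ∀ p {ε} → p ℚ.< ε → ℚ.- p ℚ.< ε → ℚ.∣ p ∣ ℚ.< ε
∣∣<-intro p {ε} p<ε -p<ε with ℚ.∣p∣≡p∨∣p∣≡-p p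
... | inj₁ eq = ≡.subst (ℚ._< ε) (≡.sym eq) p<ε
... | inj₂ eq = ≡.subst (ℚ._< ε) (≡.sym eq) -p<ε

∣+∣< : ∀ p q {ε δ} → ℚ.∣ p ∣ ℚ.< ε → ℚ.∣ q ∣ ℚ.< δ → ℚ.∣ p ℚ.+ q ∣ ℚ.< ε ℚ.+ δ
∣+∣< p q {ε} {δ} h k = ℚ.≤-<-trans (ℚ.∣p+q∣≤∣p∣+∣q∣ p q)
  (ℚ.+-mono-< {ℚ.∣ p ∣} {ε} {ℚ.∣ q ∣} {δ} h k)

-- Equality of reals

-- The content of `x ≈ y` is definitionally `Null (x - y)`, so the laws of equality reduce to
-- closure properties of null sequences.
Null : ℝ → Set
Null x = ∀ ε → 0ℚ ℚ.< ε → Eventually (λ n → ℚ.∣ seq x n ∣ ℚ.< ε)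

null-resp : ∀ {x y} → (∀ n → seq x n ≡ seq y n) → Null x → Null y
null-resp eq h ε 0<ε = ev-map (λ n → ≡.subst (λ q → ℚ.∣ q ∣ ℚ.< ε) (eq n)) (h ε 0<ε)

null-+ : ∀ x y → Null x → Null y → Null (x + y)
null-+ x y hx hy ε 0<ε =
  ev-map₂ (λ n a b → ≡.subst (ℚ.∣ seq x n ℚ.+ seq y n ∣ ℚ.<_) (halves ε)
    (∣+∣< (seq x n) (seq y n) a b)) (hx (½ ℚ.* ε) (½-pos 0<ε)) (hy (½ ℚ.* ε) (½-pos 0<ε))

null-neg : ∀ x → Null x → Null (- x)
null-neg x h ε 0<ε = ev-map (λ n → ≡.subst (ℚ._< ε) (≡.sym (ℚ.∣-p∣≡∣p∣ (seq x n)))) (h ε 0<ε)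

bounded : ∀ x → ∃[ B ] (0ℚ ℚ.< B × Eventually (λ n → ℚ.∣ seq x n ∣ ℚ.< B))
bounded x with cauchy x 1ℚ 0<1
... | N , close = 1ℚ ℚ.+ ℚ.∣ seq x N ∣ ,
  ℚ.+-mono-<-≤ {0ℚ} {1ℚ} {0ℚ} 0<1 (ℚ.0≤∣p∣ (seq x N)) , N , λ n N≤n →
    ℚ.≤-<-trans
      (≡.subst (λ q → ℚ.∣ q ∣ ℚ.≤ ℚ.∣ seq x n ℚ.- seq x N ∣ ℚ.+ ℚ.∣ seq x N ∣)
        (solve 2 (λ a b → (a :- b) :+ b := a) ≡.refl (seq x n) (seq x N))
        (ℚ.∣p+q∣≤∣p∣+∣q∣ (seq x n ℚ.- seq x N) (seq x N)))
      (ℚ.+-monoˡ-< ℚ.∣ seq x N ∣ (close n N N≤n ℕ.≤-refl))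

∣*∣< : ∀ p q {ε δ} → ℚ.∣ p ∣ ℚ.< ε → 0ℚ ℚ.< δ → ℚ.∣ q ∣ ℚ.< δ → ℚ.∣ p ℚ.* q ∣ ℚ.< δ ℚ.* ε
∣*∣< p q {ε} {δ} p<ε 0<δ q<δ = begin-strict
  ℚ.∣ p ℚ.* q ∣         ≡⟨ ℚ.∣p*q∣≡∣p∣*∣q∣ p q ⟩
  ℚ.∣ p ∣ ℚ.* ℚ.∣ q ∣   ≤⟨ ℚ.*-monoˡ-≤-nonNeg ℚ.∣ p ∣ {{ℚ.∣-∣-nonNeg p}} (ℚ.<⇒≤ q<δ) ⟩
  ℚ.∣ p ∣ ℚ.* δ         <⟨ ℚ.*-monoˡ-<-pos δ {{ℚ.positive 0<δ}} p<ε ⟩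
  ε ℚ.* δ               ≡⟨ ℚ.*-comm ε δ ⟩
  δ ℚ.* ε               ∎
  where open ℚ.≤-Reasoning

null-* : ∀ x y → Null x → Null (x * y)
null-* x y h ε 0<ε =
  let B , 0<B , y<B = bounded y
      η , 0<η , Bη≡ε = ℚ-quotient 0<B 0<ε
  in ev-map₂ (λ n a b → ≡.subst (ℚ.∣ seq x n ℚ.* seq y n ∣ ℚ.<_) Bη≡ε
       (∣*∣< (seq x n) (seq y n) a 0<B b)) (h η 0<η) y<B

pointwise : ∀ {x y} → (∀ n → seq x n ≡ seq y n) → x ≈ y
pointwise {x} {y} eq = mk≈ λ ε 0<ε → 0 , λ n _ → ≡.subst (ℚ._< ε)
  (≡.sym (≡.trans (≡.cong (λ q → ℚ.∣ q ℚ.- seq y n ∣) (eq n))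
    (≡.cong ℚ.∣_∣ (ℚ.+-inverseʳ (seq y n))))) 0<ε

≈-refl : ∀ {x} → x ≈ x
≈-refl = pointwise λ _ → ≡.refl

≈-sym : ∀ {x y} → x ≈ y → y ≈ x
≈-sym {x} {y} (mk≈ h) = mk≈ (null-resp {x = - (x - y)} {y - x}
  (λ n → solve 2 (λ x y → :- (x :- y) := y :- x) ≡.refl (seq x n) (seq y n))
  (null-neg (x - y) h))

≈-trans : ∀ {x y z} → x ≈ y → y ≈ z → x ≈ z
≈-trans {x} {y} {z} (mk≈ h) (mk≈ k) = mk≈ (null-resp {x = (x - y) + (y - z)} {x - z}
  (λ n → solve 3 (λ x y z → (x :- y) :+ (y :- z) := x :- z) ≡.refl (seq x n) (seq y n) (seq z n))
  (null-+ (x - y) (y - z) h k))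

infixl 6 _⊕_
infixl 7 _⊗_
infix  8 ⊝_

-- Opaque, because deciding equality of compound terms would otherwise compare
-- the moduli of convergence that they carry.
opaque
  _⊕_ _⊗_ : ℝ → ℝ → ℝ
  _⊕_ = _+_
  _⊗_ = _*_

  ⊝_ : ℝ → ℝ
  ⊝_ = -_

opaque
  unfolding _⊕_ _⊗_ ⊝_

  ⊕≡+ : ∀ x y → x ⊕ y ≡ x + y
  ⊕≡+ x y = ≡.refl

  ⊗≡* : ∀ x y → x ⊗ y ≡ x * y
  ⊗≡* x y = ≡.refl

  ⊝≡- : ∀ x → ⊝ x ≡ - x
  ⊝≡- x = ≡.refl

  ⊕-cong : ∀ {x x′ y y′} → x ≈ x′ → y ≈ y′ → x ⊕ y ≈ x′ ⊕ y′
  ⊕-cong {x} {x′} {y} {y′} (mk≈ h) (mk≈ k) =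
    mk≈ (null-resp {x = (x - x′) + (y - y′)} {(x + y) - (x′ + y′)}
      (λ n → solve 4 (λ x x′ y y′ → (x :- x′) :+ (y :- y′) := (x :+ y) :- (x′ :+ y′)) ≡.refl
        (seq x n) (seq x′ n) (seq y n) (seq y′ n))
      (null-+ (x - x′) (y - y′) h k))

  ⊗-cong : ∀ {x x′ y y′} → x ≈ x′ → y ≈ y′ → x ⊗ y ≈ x′ ⊗ y′
  ⊗-cong {x} {x′} {y} {y′} (mk≈ h) (mk≈ k) =
    mk≈ (null-resp {x = (x - x′) * y + (y - y′) * x′} {x * y - x′ * y′}
      (λ n → solve 4 (λ x x′ y y′ → (x :- x′) :* y :+ (y :- y′) :* x′ := x :* y :- x′ :* y′) ≡.refl
        (seq x n) (seq x′ n) (seq y n) (seq y′ n))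
      (null-+ ((x - x′) * y) ((y - y′) * x′) (null-* (x - x′) y h) (null-* (y - y′) x′ k)))

  ⊝-cong : ∀ {x y} → x ≈ y → ⊝ x ≈ ⊝ y
  ⊝-cong {x} {y} (mk≈ h) = mk≈ (null-resp {x = - (x - y)} {(- x) - (- y)}
    (λ n → solve 2 (λ x y → :- (x :- y) := (:- x) :- (:- y)) ≡.refl (seq x n) (seq y n))
    (null-neg (x - y) h))

ℝ-setoid : Setoid _ _
ℝ-setoid = record
  { Carrier = ℝ
  ; _≈_ = _≈_
  ; isEquivalence = record { refl = ≈-refl ; sym = ≈-sym ; trans = ≈-trans }
  }

-- The order on the reals

pos-intro : ∀ {x} δ → 0ℚ ℚ.< δ → Eventually (λ n → δ ℚ.≤ seq x n) → 0ℝ < x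
pos-intro {x} δ 0<δ (N , h) = mk< δ 0<δ N λ n n≥ →
  ≡.subst (ℚ._≤ seq x n) (≡.sym (ℚ.+-identityˡ δ)) (h n n≥)

pos-elim : ∀ {x} → 0ℝ < x → ∃[ δ ] (0ℚ ℚ.< δ × Eventually (λ n → δ ℚ.≤ seq x n))
pos-elim {x} (mk< δ 0<δ N h) = δ , 0<δ , N , λ n n≥ →
  ≡.subst (ℚ._≤ seq x n) (ℚ.+-identityˡ δ) (h n n≥)

pos-resp : ∀ {x y} → x ≈ y → 0ℝ < x → 0ℝ < y
pos-resp {x} {y} (mk≈ x≈y) 0<x =
  let δ , 0<δ , δ≤x = pos-elim 0<x
      h = ½ ℚ.* δ
  in pos-intro h (½-pos 0<δ) (ev-map₂ (λ n a b → 0≤-⇒≤ (≡.subst (0ℚ ℚ.≤_)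
       (≡.trans (≡.cong (λ q → (seq x n ℚ.- q) ℚ.+ (h ℚ.- (seq x n ℚ.- seq y n))) (≡.sym (halves δ)))
         (solve 3 (λ h x y → (x :- (h :+ h)) :+ (h :- (x :- y)) := y :- h) ≡.refl h (seq x n) (seq y n)))
       (ℚ.+-mono-≤ {0ℚ} {_} {0ℚ} (≤⇒0≤- a)
         (≤⇒0≤- (ℚ.≤-trans (p≤∣p∣ (seq x n ℚ.- seq y n)) (ℚ.<⇒≤ b))))))
     δ≤x (x≈y h (½-pos 0<δ)))

opaque
  unfolding _⊕_ _⊗_ ⊝_

  pos-+ : ∀ {x y} → 0ℝ < x → 0ℝ < y → 0ℝ < x ⊕ y
  pos-+ {x} {y} 0<x 0<y =
    let δ , 0<δ , δ≤x = pos-elim 0<x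
        η , 0<η , η≤y = pos-elim 0<y
    in pos-intro (δ ℚ.+ η) (ℚ+-pos δ η 0<δ 0<η)
         (ev-map₂ (λ n → ℚ.+-mono-≤ {δ} {seq x n} {η} {seq y n}) δ≤x η≤y)

  pos-* : ∀ {x y} → 0ℝ < x → 0ℝ < y → 0ℝ < x ⊗ y
  pos-* {x} {y} 0<x 0<y =
    let δ , 0<δ , δ≤x = pos-elim 0<x
        η , 0<η , η≤y = pos-elim 0<y
    in pos-intro (δ ℚ.* η) (ℚ*-pos δ η 0<δ 0<η) (ev-map₂ (λ n a b → ℚ.≤-trans
         (ℚ.*-monoˡ-≤-nonNeg δ {{ℚ.nonNegative (ℚ.<⇒≤ 0<δ)}} b)
         (ℚ.*-monoʳ-≤-nonNeg (seq y n) {{ℚ.nonNegative (ℚ.≤-trans (ℚ.<⇒≤ 0<η) b)}} a)) δ≤x η≤y)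

  -- If `x < B` and `η ≤ x y` entrywise, then `θ = η / B` satisfies `x θ ≤ B θ = η ≤ x y`, and the
  -- positive `x` cancels.
  pos-cancel : ∀ {x y} → 0ℝ < x → 0ℝ < x ⊗ y → 0ℝ < y
  pos-cancel {x} {y} 0<x 0<xy =
    let δ , 0<δ , δ≤x = pos-elim 0<x
        η , 0<η , η≤xy = pos-elim 0<xy
        B , 0<B , x<B = bounded x
        θ , 0<θ , Bθ≡η = ℚ-quotient 0<B 0<η
    in pos-intro θ 0<θ (ev-map₂ (λ n (δ≤ , η≤) x<B →
         ℚ.*-cancelˡ-≤-pos (seq x n) {{ℚ.positive (ℚ.<-≤-trans 0<δ δ≤)}}
           (ℚ.≤-trans (ℚ.≤-trans (ℚ.*-monoʳ-≤-nonNeg θ {{ℚ.nonNegative (ℚ.<⇒≤ 0<θ)}}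
               (ℚ.<⇒≤ (ℚ.≤-<-trans (p≤∣p∣ (seq x n)) x<B)))
             (ℚ.≤-reflexive Bθ≡η)) η≤))
       (ev-map₂ (λ _ a b → a , b) δ≤x η≤xy) x<B)

  <⇒pos : ∀ {x y} → x < y → 0ℝ < y ⊕ ⊝ x
  <⇒pos {x} {y} (mk< δ 0<δ N h) = pos-intro δ 0<δ (N , λ n n≥ → 0≤-⇒≤ (≡.subst (0ℚ ℚ.≤_)
    (solve 3 (λ x y d → y :- (x :+ d) := (y :- x) :- d) ≡.refl (seq x n) (seq y n) δ)
    (≤⇒0≤- (h n n≥))))

  pos⇒< : ∀ {x y} → 0ℝ < y ⊕ ⊝ x → x < y
  pos⇒< {x} {y} 0<y-x = let δ , 0<δ , N , h = pos-elim 0<y-x in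
    mk< δ 0<δ N λ n n≥ → 0≤-⇒≤ (≡.subst (0ℚ ℚ.≤_)
    (solve 3 (λ x y d → (y :- x) :- d := y :- (x :+ d)) ≡.refl (seq x n) (seq y n) δ)
    (≤⇒0≤- (h n n≥)))

<-irrefl : ∀ {x} → ¬ x < x
<-irrefl {x} (mk< δ 0<δ N h) = ℚ.<-irrefl ≡.refl (ℚ.<-≤-trans
  (≡.subst (ℚ._< seq x N ℚ.+ δ) (ℚ.+-identityʳ (seq x N)) (ℚ.+-monoʳ-< (seq x N) 0<δ)) (h N ℕ.≤-refl))

pos-fromℚ : ∀ {q} → 0ℚ ℚ.< q → 0ℝ < fromℚ q
pos-fromℚ {q} 0<q = pos-intro q 0<q (0 , λ _ _ → ℚ.≤-refl)

-- If one entry past the threshold for `ε / 2` had absolute value at least `ε`, all later entries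
-- would stay `ε / 2` away from 0 on the same side, and `x` would be apart from 0. The case
-- distinction is on rationals, hence decidable.
#0-tight : ∀ {x} → ¬ x # 0ℝ → x ≈ 0ℝ
#0-tight {x} ¬x#0 = mk≈ λ ε 0<ε → ev-map (λ n → ≡.subst (λ q → ℚ.∣ q ∣ ℚ.< ε)
    (≡.sym (ℚ.+-identityʳ (seq x n)))) (small ε 0<ε)
  where
  small : Null x
  small ε 0<ε with cauchy x (½ ℚ.* ε) (½-pos 0<ε)
  ... | N , close = N , λ n n≥ → ∣∣<-intro (seq x n) (upper n n≥) (lower n n≥)
    where
    far : ∀ n → N ≤ n → ∀ m → N ≤ m → ℚ.∣ seq x n ℚ.- seq x m ∣ ℚ.< ε ℚ.- ½ ℚ.* ε
    far n n≥ m m≥ = ≡.subst (ℚ.∣ seq x n ℚ.- seq x m ∣ ℚ.<_)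
      (≡.trans (solve 1 (λ h → h := (h :+ h) :- h) ≡.refl (½ ℚ.* ε))
        (≡.cong (λ q → q ℚ.- ½ ℚ.* ε) (halves ε)))
      (close n m n≥ m≥)
    upper : ∀ n → N ≤ n → seq x n ℚ.< ε
    upper n n≥ with seq x n ℚ.<? ε
    ... | yes p = p
    ... | no ¬p = contradiction (inj₂ (pos-intro {x} (½ ℚ.* ε) (½-pos 0<ε) (N , λ m m≥ →
      0≤-⇒≤ (≡.subst (0ℚ ℚ.≤_)
        (solve 4 (λ a b e h → (a :- e) :+ ((e :- h) :- (a :- b)) := b :- h) ≡.refl
          (seq x n) (seq x m) ε (½ ℚ.* ε))
        (ℚ.+-mono-≤ {0ℚ} {_} {0ℚ} (≤⇒0≤- (ℚ.≮⇒≥ ¬p))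
          (≤⇒0≤- (ℚ.≤-trans (p≤∣p∣ (seq x n ℚ.- seq x m)) (ℚ.<⇒≤ (far n n≥ m m≥)))))))))
      ¬x#0
    lower : ∀ n → N ≤ n → ℚ.- seq x n ℚ.< ε
    lower n n≥ with (ℚ.- seq x n) ℚ.<? ε
    ... | yes p = p
    ... | no ¬p = contradiction (inj₁ (mk< {x} {0ℝ} (½ ℚ.* ε) (½-pos 0<ε) N λ m m≥ →
      0≤-⇒≤ (≡.subst (0ℚ ℚ.≤_)
        (solve 4 (λ a b e h → ((:- a) :- e) :+ ((e :- h) :- (:- (a :- b))) := con 0ℚ :- (b :+ h)) ≡.refl
          (seq x n) (seq x m) ε (½ ℚ.* ε))
        (ℚ.+-mono-≤ {0ℚ} {_} {0ℚ} (≤⇒0≤- (ℚ.≮⇒≥ ¬p))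
          (≤⇒0≤- (ℚ.≤-trans (-p≤∣p∣ (seq x n ℚ.- seq x m)) (ℚ.<⇒≤ (far n n≥ m m≥))))))))
      ¬x#0

archimedean : ∀ x → ∃[ n ] x < fromℕ n
archimedean x =
  let B , 0<B , N , x<B = bounded x
      n , B+1<n = ℚ-archimedean (B ℚ.+ 1ℚ)
  in n , mk< 1ℚ 0<1 N λ m m≥ → ℚ.<⇒≤ (ℚ.<-trans
       (ℚ.+-monoˡ-< 1ℚ (ℚ.≤-<-trans (p≤∣p∣ (seq x m)) (x<B m m≥))) B+1<n)

opaque
  unfolding _⊕_ _⊗_ ⊝_

  -- Early entries of `x` may be 0, where `inv` has its default value; from `N` on they are at least
  -- `δ`, and the product is exactly 1.
  recip⁺-inverse : ∀ x (0<x : 0ℝ < x) → recip⁺ x 0<x ⊗ x ≈ 1ℝ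
  recip⁺-inverse x 0<x = let δ , 0<δ , N , δ≤x = pos-elim 0<x in
    mk≈ λ ε 0<ε → N , λ n n≥ → ≡.subst (ℚ._< ε)
      (≡.sym (≡.cong (λ q → ℚ.∣ q ℚ.- 1ℚ ∣) (inv-inverse (seq x n)
        λ x≡0 → ℚ.<-irrefl (≡.sym x≡0) (ℚ.<-≤-trans 0<δ (δ≤x n n≥))))) 0<ε

-- Completeness of the reals

1/suc : ∀ n → ∃[ δ ] (0ℚ ℚ.< δ × ℕ→ℚ (suc n) ℚ.* δ ≡ 1ℚ)
1/suc n = ℚ-quotient (ℚ.positive⁻¹ (ℕ→ℚ (suc n)) {{ℚ.normalize-pos (suc n) 1}}) 0<1

1/suc-vanishes : ∀ ε → 0ℚ ℚ.< ε → Eventually (λ n → proj₁ (1/suc n) ℚ.< ε)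
1/suc-vanishes ε 0<ε =
  let ρ , _ , ερ≡1 = ℚ-quotient 0<ε 0<1
      M , ρ<M = ℚ-archimedean ρ
      ρ<suc = inductive⇒≥ (λ n → ρ ℚ.< ℕ→ℚ n) ρ<M λ n h → ℚ.<-trans h
        (≡.subst (ℕ→ℚ n ℚ.<_) (≡.sym (ℕ→ℚ-suc n))
          (≡.subst (ℚ._< ℕ→ℚ n ℚ.+ 1ℚ) (ℚ.+-identityʳ (ℕ→ℚ n)) (ℚ.+-monoʳ-< (ℕ→ℚ n) 0<1)))
  in M , λ n M≤n →
    let N = ℕ→ℚ (suc n)
        δ , _ , Nδ≡1 = 1/suc n
        ρ<N = ρ<suc (suc n) (ℕ.m≤n⇒m≤1+n M≤n)
    in ℚ.*-cancelˡ-<-nonNeg N {{ℚ.pos⇒nonNeg N {{ℚ.normalize-pos (suc n) 1}}}}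
         (≡.subst₂ ℚ._<_ (≡.trans ερ≡1 (≡.sym Nδ≡1)) (ℚ.*-comm ε N)
           (ℚ.*-monoʳ-<-pos ε {{ℚ.positive 0<ε}} ρ<N))

opaque
  unfolding _⊕_ _⊗_ ⊝_

  <+⇒ev : ∀ {x y ε} → x < y ⊕ fromℚ ε → Eventually (λ k → seq x k ℚ.- seq y k ℚ.< ε)
  <+⇒ev {x} {y} {ε} (mk< g 0<g N h) = N , λ k k≥ → ℚ.<-≤-trans
    (≡.subst (ℚ._< (seq x k ℚ.- seq y k) ℚ.+ g) (ℚ.+-identityʳ (seq x k ℚ.- seq y k))
      (ℚ.+-monoʳ-< (seq x k ℚ.- seq y k) 0<g))
    (0≤-⇒≤ (≡.subst (0ℚ ℚ.≤_)
      (solve 4 (λ x y e g → (y :+ e) :- (x :+ g) := e :- ((x :- y) :+ g)) ≡.refl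
        (seq x k) (seq y k) ε g)
      (≤⇒0≤- (h k k≥))))

∣-∣<⇒<+ : ∀ {p q ε} → ℚ.∣ p ℚ.- q ∣ ℚ.< ε → p ℚ.- q ℚ.< ε × q ℚ.- p ℚ.< ε
∣-∣<⇒<+ {p} {q} h = ℚ.≤-<-trans (p≤∣p∣ (p ℚ.- q)) h ,
  ℚ.≤-<-trans (≡.subst (ℚ._≤ ℚ.∣ p ℚ.- q ∣)
    (solve 2 (λ p q → :- (p :- q) := q :- p) ≡.refl p q) (-p≤∣p∣ (p ℚ.- q))) h

∣-∣-triangle : ∀ p q r {ε} → ℚ.∣ p ℚ.- q ∣ ℚ.< ½ ℚ.* ε → ℚ.∣ q ℚ.- r ∣ ℚ.< ½ ℚ.* ε → ℚ.∣ p ℚ.- r ∣ ℚ.< ε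
∣-∣-triangle p q r {ε} h k = ≡.subst₂ (λ x y → ℚ.∣ x ∣ ℚ.< y)
  (solve 3 (λ p q r → (p :- q) :+ (q :- r) := p :- r) ≡.refl p q r) (halves ε)
  (∣+∣< (p ℚ.- q) (q ℚ.- r) h k)

∣-∣-sym : ∀ p q {ε} → ℚ.∣ p ℚ.- q ∣ ℚ.< ε → ℚ.∣ q ℚ.- p ∣ ℚ.< ε
∣-∣-sym p q {ε} = ≡.subst (ℚ._< ε) (≡.trans (≡.sym (ℚ.∣-p∣≡∣p∣ (p ℚ.- q)))
  (≡.cong ℚ.∣_∣ (solve 2 (λ p q → :- (p :- q) := q :- p) ≡.refl p q)))

∣-∣-eventually : ∀ x y {ε} → x < y ⊕ fromℚ ε → y < x ⊕ fromℚ ε →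
  Eventually (λ k → ℚ.∣ seq x k ℚ.- seq y k ∣ ℚ.< ε)
∣-∣-eventually x y {ε} x<y+ε y<x+ε = ev-map₂
  (λ k a b → ∣∣<-intro (seq x k ℚ.- seq y k) a (≡.subst (ℚ._< ε)
    (solve 2 (λ p q → p :- q := :- (q :- p)) ≡.refl (seq y k) (seq x k)) b))
  (<+⇒ev {x} {y} x<y+ε) (<+⇒ev {y} {x} y<x+ε)

<+half⇒≤+ : ∀ {p q e η} → p ℚ.- q ℚ.< ½ ℚ.* η → η ℚ.≤ e → p ℚ.+ ½ ℚ.* η ℚ.≤ q ℚ.+ e
<+half⇒≤+ {p} {q} {e} {η} p-q<h η≤e = 0≤-⇒≤ (≡.subst (0ℚ ℚ.≤_)
  (solve 4 (λ p q e h → (h :- (p :- q)) :+ (e :- (h :+ h)) := (q :+ e) :- (p :+ h)) ≡.refl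
    p q e (½ ℚ.* η))
  (ℚ.+-mono-≤ {0ℚ} {_} {0ℚ} (≤⇒0≤- (ℚ.<⇒≤ p-q<h))
    (≤⇒0≤- (≡.subst (ℚ._≤ e) (≡.sym (halves η)) η≤e))))

≤+⇒-≤ : ∀ {p q e h} → p ℚ.+ h ℚ.≤ q ℚ.+ e → (p ℚ.- e) ℚ.+ h ℚ.≤ q
≤+⇒-≤ {p} {q} {e} {h} le = 0≤-⇒≤ (≡.subst (0ℚ ℚ.≤_)
  (solve 4 (λ p q e h → (q :+ e) :- (p :+ h) := q :- ((p :- e) :+ h)) ≡.refl p q e h) (≤⇒0≤- le))

opaque
  unfolding _⊕_ _⊗_ ⊝_

  -- The rational `η` below `ε` is split: one half absorbs the distance between `x` and `y`, the
  -- other is the gap that a strict inequality must exhibit.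
  close⇒< : ∀ {x y ε} η → 0ℚ ℚ.< η → Eventually (λ k → η ℚ.≤ seq ε k) →
    Eventually (λ k → ℚ.∣ seq x k ℚ.- seq y k ∣ ℚ.< ½ ℚ.* η) → (x ⊕ ⊝ ε < y) × (y < x ⊕ ε)
  close⇒< {x} {y} {ε} η 0<η η≤ε close =
    let N , x-ε≤y = ev-map₂ {T = λ k → (seq x k ℚ.- seq ε k) ℚ.+ ½ ℚ.* η ℚ.≤ seq y k} (λ k c e →
          ≤+⇒-≤ {seq x k} {seq y k} {seq ε k} {½ ℚ.* η}
            (<+half⇒≤+ {seq x k} {seq y k} {seq ε k} {η}
              (proj₁ (∣-∣<⇒<+ {seq x k} {seq y k} c)) e)) close η≤ε
        M , y≤x+ε = ev-map₂ {T = λ k → seq y k ℚ.+ ½ ℚ.* η ℚ.≤ seq x k ℚ.+ seq ε k} (λ k c e →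
          <+half⇒≤+ {seq y k} {seq x k} {seq ε k} {η}
            (proj₂ (∣-∣<⇒<+ {seq x k} {seq y k} c)) e) close η≤ε
    in mk< (½ ℚ.* η) (½-pos 0<η) N x-ε≤y , mk< (½ ℚ.* η) (½-pos 0<η) M y≤x+ε

CauchyReals : (ℕ → ℝ) → Set
CauchyReals u = ∀ ε → 0ℝ < ε → ∃[ N ] ∀ n → N ≤ n → (u N < u n ⊕ ε) × (u n < u N ⊕ ε)

module Limit (u : ℕ → ℝ) (u-cauchy : CauchyReals u) where

  δ : ℕ → ℚ
  δ n = proj₁ (1/suc n)

  index : ℕ → ℕ
  index n = proj₁ (cauchy (u n) (δ n) (proj₁ (proj₂ (1/suc n))))

  -- The limit takes from u n an entry within 1 / (n + 1) of all later ones.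
  s : ℕ → ℚ
  s n = seq (u n) (index n)

  s-near : ∀ n k → index n ≤ k → ℚ.∣ s n ℚ.- seq (u n) k ∣ ℚ.< δ n
  s-near n k = proj₂ (cauchy (u n) (δ n) (proj₁ (proj₂ (1/suc n)))) (index n) k ℕ.≤-refl

  -- A rational is near the real `u M` when it is near all late entries of it; the triangle passes
  -- through the same entry of `u n`.
  s-near-pivot : ∀ M n ε → u M < u n ⊕ fromℚ (½ ℚ.* ε) → u n < u M ⊕ fromℚ (½ ℚ.* ε) →
    δ n ℚ.< ½ ℚ.* ε → Eventually (λ k → ℚ.∣ s n ℚ.- seq (u M) k ∣ ℚ.< ε)
  s-near-pivot M n ε M<n n<M δ<h = ev-map₂
    {λ k → ℚ.∣ s n ℚ.- seq (u n) k ∣ ℚ.< ½ ℚ.* ε} {λ k → ℚ.∣ seq (u n) k ℚ.- seq (u M) k ∣ ℚ.< ½ ℚ.* ε}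
    (λ k → ∣-∣-triangle (s n) (seq (u n) k) (seq (u M) k) {ε})
    (index n , λ k k≥ → ℚ.<-trans (s-near n k k≥) δ<h)
    (∣-∣-eventually (u n) (u M) {½ ℚ.* ε} n<M M<n)

  CloseFrom : ℚ → ℕ → ℕ → Set
  CloseFrom ε M n = (u M < u n ⊕ fromℚ ε) × (u n < u M ⊕ fromℚ ε)

  NearPivot : ℚ → ℕ → ℕ → Set
  NearPivot ε M n = Eventually (λ k → ℚ.∣ s n ℚ.- seq (u M) k ∣ ℚ.< ε)

  s-pivot-from : ∀ ε → 0ℚ ℚ.< ε → ∀ M → (∀ n → M ≤ n → CloseFrom (½ ℚ.* ε) M n) →
    Eventually (NearPivot ε M)
  s-pivot-from ε 0<ε M close = ev-map₂ {CloseFrom (½ ℚ.* ε) M} {λ n → δ n ℚ.< ½ ℚ.* ε} {NearPivot ε M}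
    (λ n c → s-near-pivot M n ε (proj₁ c) (proj₂ c)) (M , close) (1/suc-vanishes (½ ℚ.* ε) (½-pos 0<ε))

  s-pivot : ∀ ε → 0ℚ ℚ.< ε → ∃[ M ] Eventually (NearPivot ε M)
  s-pivot ε 0<ε =
    let M , close = u-cauchy (fromℚ (½ ℚ.* ε)) (pos-fromℚ (½-pos 0<ε))
    in M , s-pivot-from ε 0<ε M close

  -- Both `s m` and `s n` are compared with one entry `k` of the pivot. How late `k` must be depends
  -- on `m` and `n`, but the resulting inequality no longer mentions it.
  s-cauchy : IsCauchy s
  s-cauchy ε 0<ε =
    let M , N , close = s-pivot (½ ℚ.* ε) (½-pos 0<ε)
    in N , λ m n m≥ n≥ → proj₂ (ev-witness (ev-map₂ {T = λ _ → ℚ.∣ s m ℚ.- s n ∣ ℚ.< ε}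
         (λ k sm sn → ∣-∣-triangle (s m) (seq (u M) k) (s n) sm (∣-∣-sym (s n) (seq (u M) k) sn))
         (close m m≥) (close n n≥)))

  limit : ℝ
  limit = mkℝ s s-cauchy

  -- The limit has `s k` at position `k`, while `u n` is near `s n` there; the Cauchy property of
  -- `s` links the two.
  s-u-close : ∀ ε → 0ℚ ℚ.< ε → Eventually (λ n → Eventually (λ k → ℚ.∣ s k ℚ.- seq (u n) k ∣ ℚ.< ε))
  s-u-close ε 0<ε =
    let h = ½ ℚ.* ε
        N , close = s-cauchy h (½-pos 0<ε)
    in ev-map₂ (λ n n≥ δ<h → ev-map₂ (λ k k≥ s-un →
           ∣-∣-triangle (s k) (s n) (seq (u n) k) (close k n k≥ n≥) s-un)
         (N , λ k k≥ → k≥) (index n , λ k k≥ → ℚ.<-trans (s-near n k k≥) δ<h))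
       (N , λ n n≥ → n≥) (1/suc-vanishes h (½-pos 0<ε))

  converges : ∀ ε → 0ℝ < ε → Eventually (λ n → (limit ⊕ ⊝ ε < u n) × (u n < limit ⊕ ε))
  converges ε 0<ε =
    let η , 0<η , η≤ε = pos-elim 0<ε
    in ev-map {λ n → Eventually (λ k → ℚ.∣ s k ℚ.- seq (u n) k ∣ ℚ.< ½ ℚ.* η)}
         {λ n → (limit ⊕ ⊝ ε < u n) × (u n < limit ⊕ ε)}
         (λ n close → close⇒< {limit} {u n} {ε} η 0<η η≤ε close)
         (s-u-close (½ ℚ.* η) (½-pos 0<η))

opaque
  unfolding _⊕_ _⊗_ ⊝_

  ⊕-assoc : ∀ x y z → (x ⊕ y) ⊕ z ≈ x ⊕ (y ⊕ z)
  ⊕-assoc x y z = pointwise {(x ⊕ y) ⊕ z} {x ⊕ (y ⊕ z)} λ n → ℚ.+-assoc (seq x n) (seq y n) (seq z n)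

  ⊗-assoc : ∀ x y z → (x ⊗ y) ⊗ z ≈ x ⊗ (y ⊗ z)
  ⊗-assoc x y z = pointwise {(x ⊗ y) ⊗ z} {x ⊗ (y ⊗ z)} λ n → ℚ.*-assoc (seq x n) (seq y n) (seq z n)

  ⊕-comm : ∀ x y → x ⊕ y ≈ y ⊕ x
  ⊕-comm x y = pointwise {x ⊕ y} {y ⊕ x} λ n → ℚ.+-comm (seq x n) (seq y n)

  ⊗-comm : ∀ x y → x ⊗ y ≈ y ⊗ x
  ⊗-comm x y = pointwise {x ⊗ y} {y ⊗ x} λ n → ℚ.*-comm (seq x n) (seq y n)

  ⊕-identityˡ : ∀ x → 0ℝ ⊕ x ≈ x
  ⊕-identityˡ x = pointwise {0ℝ ⊕ x} {x} λ n → ℚ.+-identityˡ (seq x n)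

  ⊕-identityʳ : ∀ x → x ⊕ 0ℝ ≈ x
  ⊕-identityʳ x = pointwise {x ⊕ 0ℝ} {x} λ n → ℚ.+-identityʳ (seq x n)

  ⊗-identityˡ : ∀ x → 1ℝ ⊗ x ≈ x
  ⊗-identityˡ x = pointwise {1ℝ ⊗ x} {x} λ n → ℚ.*-identityˡ (seq x n)

  ⊗-identityʳ : ∀ x → x ⊗ 1ℝ ≈ x
  ⊗-identityʳ x = pointwise {x ⊗ 1ℝ} {x} λ n → ℚ.*-identityʳ (seq x n)

  ⊕-inverseˡ : ∀ x → (⊝ x) ⊕ x ≈ 0ℝ
  ⊕-inverseˡ x = pointwise {(⊝ x) ⊕ x} {0ℝ} λ n → ℚ.+-inverseˡ (seq x n)

  ⊕-inverseʳ : ∀ x → x ⊕ (⊝ x) ≈ 0ℝ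
  ⊕-inverseʳ x = pointwise {x ⊕ (⊝ x)} {0ℝ} λ n → ℚ.+-inverseʳ (seq x n)

  ⊗-distribˡ-⊕ : ∀ x y z → x ⊗ (y ⊕ z) ≈ (x ⊗ y) ⊕ (x ⊗ z)
  ⊗-distribˡ-⊕ x y z = pointwise {x ⊗ (y ⊕ z)} {(x ⊗ y) ⊕ (x ⊗ z)} λ n →
    ℚ.*-distribˡ-+ (seq x n) (seq y n) (seq z n)

  ⊗-distribʳ-⊕ : ∀ x y z → (y ⊕ z) ⊗ x ≈ (y ⊗ x) ⊕ (z ⊗ x)
  ⊗-distribʳ-⊕ x y z = pointwise {(y ⊕ z) ⊗ x} {(y ⊗ x) ⊕ (z ⊗ x)} λ n →
    ℚ.*-distribʳ-+ (seq x n) (seq y n) (seq z n)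

  fromℚ-⊕ : ∀ p q → fromℚ (p ℚ.+ q) ≈ fromℚ p ⊕ fromℚ q
  fromℚ-⊕ p q = pointwise {fromℚ (p ℚ.+ q)} {fromℚ p ⊕ fromℚ q} λ _ → ≡.refl

  fromℚ-⊗ : ∀ p q → fromℚ (p ℚ.* q) ≈ fromℚ p ⊗ fromℚ q
  fromℚ-⊗ p q = pointwise {fromℚ (p ℚ.* q)} {fromℚ p ⊗ fromℚ q} λ _ → ≡.refl

  fromℚ-⊝ : ∀ p → fromℚ (ℚ.- p) ≈ ⊝ fromℚ p
  fromℚ-⊝ p = pointwise {fromℚ (ℚ.- p)} {⊝ fromℚ p} λ _ → ≡.refl

ℝ-isCommutativeRing : IsCommutativeRing _≈_ _⊕_ _⊗_ ⊝_ 0ℝ 1ℝ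
ℝ-isCommutativeRing = record
  { isRing = record
    { +-isAbelianGroup = record
      { isGroup = record
        { isMonoid = record
          { isSemigroup = record
            { isMagma = record
              { isEquivalence = Setoid.isEquivalence ℝ-setoid
              ; ∙-cong = λ {x} {x′} {y} {y′} → ⊕-cong {x} {x′} {y} {y′}
              }
            ; assoc = ⊕-assoc
            }
          ; identity = ⊕-identityˡ , ⊕-identityʳ
          }
        ; inverse = ⊕-inverseˡ , ⊕-inverseʳ
        ; ⁻¹-cong = λ {x} {y} → ⊝-cong {x} {y}
        }
      ; comm = ⊕-comm
      }
    ; *-cong = λ {x} {x′} {y} {y′} → ⊗-cong {x} {x′} {y} {y′}
    ; *-assoc = ⊗-assoc
    ; *-identity = ⊗-identityˡ , ⊗-identityʳ
    ; distrib = ⊗-distribˡ-⊕ , ⊗-distribʳ-⊕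
    }
  ; *-comm = ⊗-comm
  }

ℝ-field : CompleteField
ℝ-field = record
  { Carrier = ℝ
  ; _≈_ = _≈_
  ; _<_ = _<_
  ; _+_ = _⊕_
  ; _*_ = _⊗_
  ; -_ = ⊝_
  ; fromℚ = fromℚ
  ; isCommutativeRing = ℝ-isCommutativeRing
  ; fromℚ-+ = fromℚ-⊕
  ; fromℚ-* = fromℚ-⊗
  ; fromℚ-neg = fromℚ-⊝
  ; <-irrefl = <-irrefl
  ; <⇒pos = λ {x} {y} → <⇒pos {x} {y}
  ; pos⇒< = λ {x} {y} → pos⇒< {x} {y}
  ; pos-resp = λ {x} {y} → pos-resp {x} {y}
  ; pos-+ = λ {x} {y} → pos-+ {x} {y}
  ; pos-* = λ {x} {y} → pos-* {x} {y}
  ; pos-cancel = λ {x} {y} → pos-cancel {x} {y}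
  ; pos-fromℚ = pos-fromℚ
  ; #0-tight = #0-tight
  ; archimedean = archimedean
  ; inverse = λ x 0<x → recip⁺ x 0<x , recip⁺-inverse x 0<x
  ; complete = λ u u-cauchy → Limit.limit u u-cauchy , Limit.converges u u-cauchy
  }

-- Transfer from the abstract theory to the polynomials and series over ℝ

module Real = Theory ℝ-field

coeff≡ : ∀ p i → Real.coeff p i ≡ coeff p i
coeff≡ []      i       = ≡.refl
coeff≡ (a ∷ p) zero    = ≡.refl
coeff≡ (a ∷ p) (suc i) = coeff≡ p i

⊕-⊗≡ : ∀ a x y z → y ≡ z → a ⊕ x ⊗ y ≡ a + x * z
⊕-⊗≡ a x y z ≡.refl = ≡.subst (λ w → a ⊕ x ⊗ y ≡ a + w) {x ⊗ y} {x * y} (⊗≡* x y) (⊕≡+ a (x ⊗ y))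

-- The opaque operations are names for the concrete ones, so this is `≡` and not merely `≈`; strict
-- inequalities transfer by substitution.
eval≡ : ∀ p x → Real.eval p x ≡ eval p x
eval≡ []      x = ≡.refl
eval≡ (a ∷ p) x = ⊕-⊗≡ a x (Real.eval p x) (eval p x) (eval≡ p x)

eval-⊕≡ : ∀ p x y → Real.eval p (x ⊕ y) ≡ eval p (x + y)
eval-⊕≡ p x y = ≡.subst (λ w → Real.eval p (x ⊕ y) ≡ eval p w) {x ⊕ y} {x + y}
  (⊕≡+ x y) (eval≡ p (x ⊕ y))

⊕1≡ : ∀ {x y} → x ≡ y → x ⊕ 1ℝ ≡ y + 1ℝ
⊕1≡ {x} ≡.refl = ⊕≡+ x 1ℝ

⊕⊝≡ : ∀ x y → x ⊕ ⊝ y ≡ x - y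
⊕⊝≡ x y = ≡.subst (λ w → x ⊕ ⊝ y ≡ x + w) {⊝ y} { - y} (⊝≡- y) (⊕≡+ x (⊝ y))

partialSum≡ : ∀ t m → Real.partialSum t m ≡ partialSum t m
partialSum≡ t zero    = ≡.refl
partialSum≡ t (suc m) = ≡.subst (λ w → Real.partialSum t m ⊕ t m ≡ w + t m)
  {Real.partialSum t m} {partialSum t m} (partialSum≡ t m)
  (⊕≡+ (Real.partialSum t m) (t m))

Within : ℝ → ℝ → ℝ → Set
Within l r s = (l < s) × (s < r)

within-subst : ∀ {l l′ r r′ s s′} → l ≡ l′ → r ≡ r′ → s ≡ s′ → Within l r s → Within l′ r′ s′
within-subst ≡.refl ≡.refl ≡.refl w = w

hasSum-to : ∀ t S → Real.HasSum t S → HasSum t S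
hasSum-to t S h ε 0<ε = let N , close = h ε 0<ε in
  N , λ n N≤n → within-subst (⊕⊝≡ S ε) (⊕≡+ S ε) (partialSum≡ t n) (close n N≤n)

hasSum-from : ∀ t S → HasSum t S → Real.HasSum t S
hasSum-from t S h ε 0<ε = let N , close = h ε 0<ε in
  N , λ n N≤n → within-subst (≡.sym (⊕⊝≡ S ε)) (≡.sym (⊕≡+ S ε)) (≡.sym (partialSum≡ t n)) (close n N≤n)

p-p≈0 : ∀ {x y} → x ≈ y → x - y ≈ 0ℝ
p-p≈0 {x} {y} (mk≈ h) = mk≈ (null-resp {x = x - y} {(x - y) - 0ℝ}
  (λ n → solve 1 (λ x → x := x :- con 0ℚ) ≡.refl (seq x n ℚ.- seq y n)) h)

seq-coeff--ₚ : ∀ p q i n → seq (coeff (p -ₚ q) i) n ≡ seq (coeff p i) n ℚ.- seq (coeff q i) n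
seq-coeff--ₚ []      []      i       n = ≡.refl
seq-coeff--ₚ []      (b ∷ q) zero    n = ≡.sym (ℚ.+-identityˡ (ℚ.- seq b n))
seq-coeff--ₚ []      (b ∷ q) (suc i) n = seq-coeff--ₚ [] q i n
seq-coeff--ₚ (a ∷ p) []      i       n = ≡.sym (ℚ.+-identityʳ (seq (coeff (a ∷ p) i) n))
seq-coeff--ₚ (a ∷ p) (b ∷ q) zero    n = ≡.refl
seq-coeff--ₚ (a ∷ p) (b ∷ q) (suc i) n = seq-coeff--ₚ p q i n

coeff--ₚ : ∀ p q i → coeff (p -ₚ q) i ≈ coeff p i - coeff q i
coeff--ₚ p q i = pointwise {coeff (p -ₚ q) i} {coeff p i - coeff q i} (seq-coeff--ₚ p q i)

≋constant : ∀ p c → coeff p 0 ≈ c → (∀ i → coeff p (suc i) ≈ 0ℝ) → p ≋ constant c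
≋constant p c p₀≈c h zero    = p₀≈c
≋constant p c p₀≈c h (suc i) = h i

difference-constant : ∀ p q → (∀ i → coeff p (suc i) ≈ coeff q (suc i)) → ∃[ c ] (p -ₚ q) ≋ constant c
difference-constant p q h = coeff p 0 - coeff q 0 ,
  ≋constant (p -ₚ q) (coeff p 0 - coeff q 0) (coeff--ₚ p q 0) λ i →
    ≈-trans {coeff (p -ₚ q) (suc i)} {coeff p (suc i) - coeff q (suc i)} {0ℝ}
      (coeff--ₚ p q (suc i)) (p-p≈0 {coeff p (suc i)} {coeff q (suc i)} (h i))

lead-from : ∀ p k → (∀ i → k ℕ.< i → coeff p i ≈ 0ℝ) → Real.Lead p k (coeff p k)
lead-from p k h = ≡.subst (Real.coeff p k ≈_) (coeff≡ p k) (≈-refl {Real.coeff p k}) ,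
  λ i k<i → ≡.subst (_≈ 0ℝ) (≡.sym (coeff≡ p i)) (h i k<i)

lead⇒degree : ∀ p k {b} → 0ℝ < b → Real.Lead p k b → HasDegree p k
lead⇒degree p k {b} 0<b (l , h) =
  inj₂ (pos-resp {b} {coeff p k} (≈-sym {coeff p k} {b} (≡.subst (_≈ b) (coeff≡ p k) l)) 0<b) ,
  λ i k<i → ≡.subst (_≈ 0ℝ) (coeff≡ p i) (h i k<i)

-- Replaces an integer threshold, possibly negative, by a natural one.
≤∣∣ : ∀ z n → ℤ.∣ z ∣ ≤ n → z ℤ.≤ + n
≤∣∣ (+ m)      n m≤n = ℤ.+≤+ m≤n
≤∣∣ ℤ.-[1+ m ] n _   = ℤ.-≤+

module _ (K₁ : ℕ) (P : Poly) (P≈0 : ∀ i → suc (suc K₁) ℕ.< i → coeff P i ≈ 0ℝ)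
  (0<a : 0ℝ < coeff P (suc (suc K₁))) where

  lead-P : Real.Lead P (suc (suc K₁)) (coeff P (suc (suc K₁)))
  lead-P = lead-from P (suc (suc K₁)) P≈0

  module _ (i₀ : ℝ) (pos : PositiveBeyond P i₀) (n : ℕ) where

    Bounds : Poly → Set
    Bounds f = ∃[ S ] HasSum (tail P i₀ pos n) S × Σ[ 0<S ∈ 0ℝ < S ]
      (eval f (fromℕ n + i₀) < recip⁺ S 0<S) × (recip⁺ S 0<S < eval f (fromℕ n + i₀) + 1ℝ)

    term-inverse : ∀ j → term P i₀ pos j ⊗ eval P (fromℕ (suc j) + i₀) ≈ 1ℝ
    term-inverse j = recip⁺-inverse (eval P (fromℕ (suc j) + i₀))
      (pos (fromℕ (suc j) + i₀) (i₀<suc+i₀ i₀ j))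

    tail-inverse : ∀ m → tail P i₀ pos n m ⊗ Real.eval P (fromℕ (suc (n ℕ.+ m)) ⊕ i₀) ≈ 1ℝ
    tail-inverse m = ≡.subst (λ y → term P i₀ pos (n ℕ.+ m) ⊗ y ≈ 1ℝ)
      {eval P (fromℕ (suc (n ℕ.+ m)) + i₀)} {Real.eval P (fromℕ (suc (n ℕ.+ m)) ⊕ i₀)}
      (≡.sym (eval-⊕≡ P (fromℕ (suc (n ℕ.+ m))) i₀)) (term-inverse (n ℕ.+ m))

    tail-pos : ∀ m → 0ℝ < tail P i₀ pos n m
    tail-pos m = Real.pos-inverse {eval P (fromℕ (suc (n ℕ.+ m)) + i₀)} {term P i₀ pos (n ℕ.+ m)}
      (pos (fromℕ (suc (n ℕ.+ m)) + i₀) (i₀<suc+i₀ i₀ (n ℕ.+ m))) (term-inverse (n ℕ.+ m))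

    φ≡ : ∀ h → Real.eval h (fromℕ n ⊕ i₀) ≡ eval h (fromℕ n + i₀)
    φ≡ h = eval-⊕≡ h (fromℕ n) i₀

    AbstractBounds : Poly → Set
    AbstractBounds f = ∃[ S ] Real.HasSum (tail P i₀ pos n) S × 0ℝ < S × ∀ R → R ⊗ S ≈ 1ℝ →
      Real.eval f (fromℕ n ⊕ i₀) < R × R < Real.eval f (fromℕ n ⊕ i₀) ⊕ 1ℝ

    bounds-from : ∀ f → AbstractBounds f → Bounds f
    bounds-from f (S , t→S , 0<S , bounds) = S , hasSum-to (tail P i₀ pos n) S t→S , 0<S ,
      ≡.subst (λ y → y < recip⁺ S 0<S) {Real.eval f (fromℕ n ⊕ i₀)} {eval f (fromℕ n + i₀)}
        (φ≡ f) (proj₁ (bounds (recip⁺ S 0<S) (recip⁺-inverse S 0<S))) ,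
      ≡.subst (λ y → recip⁺ S 0<S < y)
        {Real.eval f (fromℕ n ⊕ i₀) ⊕ 1ℝ} {eval f (fromℕ n + i₀) + 1ℝ}
        (⊕1≡ {Real.eval f (fromℕ n ⊕ i₀)} {eval f (fromℕ n + i₀)} (φ≡ f))
        (proj₂ (bounds (recip⁺ S 0<S) (recip⁺-inverse S 0<S)))

    approximates⇒bounds : ∀ f → Real.Approximates P f i₀ n → Bounds f
    approximates⇒bounds f h = bounds-from f (h (tail P i₀ pos n) tail-inverse tail-pos)

    no-gap : ∀ {S S′} f g (0<S : 0ℝ < S) (0<S′ : 0ℝ < S′) →
      HasSum (tail P i₀ pos n) S → HasSum (tail P i₀ pos n) S′ →
      eval g (fromℕ n + i₀) < recip⁺ S 0<S → recip⁺ S′ 0<S′ < eval f (fromℕ n + i₀) + 1ℝ →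
      ¬ Real.eval f (fromℕ n ⊕ i₀) ⊕ 1ℝ < Real.eval g (fromℕ n ⊕ i₀)
    no-gap {S} {S′} f g 0<S 0<S′ t→S t→S′ g<R R′<f+1 =
      Real.noGap-between {tail P i₀ pos n} {S} {S′} {recip⁺ S 0<S} {recip⁺ S′ 0<S′}
        {Real.eval f (fromℕ n ⊕ i₀)} {Real.eval g (fromℕ n ⊕ i₀)}
        (hasSum-from (tail P i₀ pos n) S t→S) (hasSum-from (tail P i₀ pos n) S′ t→S′)
        (recip⁺-inverse S 0<S) (recip⁺-inverse S′ 0<S′) 0<S 0<S′
        (≡.subst (λ y → y < recip⁺ S 0<S) {eval g (fromℕ n + i₀)} {Real.eval g (fromℕ n ⊕ i₀)}
          (≡.sym (φ≡ g)) g<R)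
        (≡.subst (λ y → recip⁺ S′ 0<S′ < y)
          {eval f (fromℕ n + i₀) + 1ℝ} {Real.eval f (fromℕ n ⊕ i₀) ⊕ 1ℝ}
          (≡.sym (⊕1≡ {Real.eval f (fromℕ n ⊕ i₀)} {eval f (fromℕ n + i₀)} (φ≡ f))) R′<f+1)

    bounds⇒noGap : ∀ f g → Bounds f → Bounds g →
      ¬ Real.eval f (fromℕ n ⊕ i₀) ⊕ 1ℝ < Real.eval g (fromℕ n ⊕ i₀)
    bounds⇒noGap f g (S′ , t→S′ , 0<S′ , _ , R′<f+1) (S , t→S , 0<S , g<R , _) =
      no-gap {S} {S′} f g 0<S 0<S′ t→S t→S′ g<R R′<f+1

  approximates : ∀ f → (∀ i₀ → Eventually (Real.Approximates P f i₀)) → Approximates P f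
  approximates f h i₀ pos = let N , approx = h i₀ in
    + N , λ n N≤n → approximates⇒bounds i₀ pos n f (approx n (ℤ.drop‿+≤+ N≤n))

  existence : ∃[ f ] HasDegree f (suc K₁) × Approximates P f
  existence = from-abstract (Real.existence K₁ P lead-P 0<a)
    where
    from-abstract : (∃[ f ] (∃[ b ] 0ℝ < b × Real.Lead f (suc K₁) b) ×
        (∀ i₀ → Eventually (Real.Approximates P f i₀))) →
      ∃[ f ] HasDegree f (suc K₁) × Approximates P f
    from-abstract (f , (b , 0<b , lead-f) , h) = f , lead⇒degree f (suc K₁) 0<b lead-f , approximates f h

  -- `Approximates` is informative only where an admissible `i₀` exists; uniqueness starts from this
  -- one.
  eventually-positive : ∃[ X ] PositiveBeyond P (fromℕ X)
  eventually-positive =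
    let X , 0<P = Real.eventually-pos {Real.eval P} (P , lead-P , λ x → ≈-refl {Real.eval P x}) 0<a
    in X , λ x X<x → ≡.subst (0ℝ <_) (eval≡ P x) (0<P x X<x)

  approximates⇒noGap : ∀ f g i₀ → PositiveBeyond P i₀ → Approximates P f → Approximates P g →
    Real.Uniqueness.NoGap i₀ f g
  approximates⇒noGap f g i₀ pos f≈ g≈ =
    let N , f-bounds = f≈ i₀ pos
        M , g-bounds = g≈ i₀ pos
    in ev-map₂ {Bounds′ f} {Bounds′ g} (λ n → bounds⇒noGap i₀ pos n f g)
         (ℤ.∣ N ∣ , λ n n≥ → f-bounds n (≤∣∣ N n n≥)) (ℤ.∣ M ∣ , λ n n≥ → g-bounds n (≤∣∣ M n n≥))
    where
    Bounds′ : Poly → ℕ → Set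
    Bounds′ h n = Bounds i₀ pos n h

  uniqueness : ∀ f g → HasDegree f (suc K₁) → HasDegree g (suc K₁) →
    Approximates P f → Approximates P g → ∃[ c ] (f -ₚ g) ≋ constant c
  uniqueness f g (_ , f≈0) (_ , g≈0) f≈ g≈ = difference-constant f g (λ i →
    ≡.subst₂ _≈_ {Real.coeff f (suc i)} {coeff f (suc i)} {Real.coeff g (suc i)} {coeff g (suc i)}
      (coeff≡ f (suc i)) (coeff≡ g (suc i)) (agree eventually-positive i))
    where
    agree : (∃[ X ] PositiveBeyond P (fromℕ X)) → ∀ i → Real.coeff f (suc i) ≈ Real.coeff g (suc i)
    agree (X , pos) = Real.Uniqueness.coeffs-agree (fromℕ X) f g (suc K₁)
      (proj₂ (lead-from f (suc K₁) f≈0)) (proj₂ (lead-from g (suc K₁) g≈0))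
      (approximates⇒noGap f g (fromℕ X) pos f≈ g≈) (approximates⇒noGap g f (fromℕ X) pos g≈ f≈)

theorem1p2 : (k : ℕ) → 2 ≤ k → (P : Poly) → HasDegree P k → 0ℝ < coeff P k →
    (∃[ f ] HasDegree f (k ∸ 1) × Approximates P f) ×
    (∀ f g → HasDegree f (k ∸ 1) → HasDegree g (k ∸ 1) →
    Approximates P f → Approximates P g →
    ∃[ c ] (f -ₚ g) ≋ constant c)
theorem1p2 (suc (suc K₁)) (ℕ.s≤s (ℕ.s≤s ℕ.z≤n)) P (_ , P≈0) 0<a =
  existence K₁ P P≈0 0<a , uniqueness K₁ P P≈0 0<a
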